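{- Let $\mathbf{A}$ be a fixed finite $\sigma$-structure. The following are equivalent: (1) $\mathrm{CSP}(\mathbf{A})$ is closed under $\equiv_1$-equivalence, i.e., for all $\sigma$-structures $\mathbf{X}_1,\mathbf{X}_2$ with $\mathbf{X}_1\equiv_1\mathbf{X}_2$ we have $\mathbf{X}_1\to\mathbf{A}$ if and only if $\mathbf{X}_2\to\mathbf{A}$; (2) $\mathrm{SA}^1$ decides $\mathrm{CSP}(\mathbf{A})$; (3) $\mathrm{BLP}$ decides $\mathrm{CSP}(\mathbf{A})$; (4) $\mathbf{A}$ has symmetric polymorphisms of all arities.
   Context: A signature $\sigma$ is a finite set of relation symbols with arities; a $\sigma$-structure $\mathbf{A}$ is a finite universe $A$ with a non-empty relation $R^{\mathbf{A}}\subseteq A^{\operatorname{ar}(R)}$ for each $R\in\sigma$. $\mathbf{X}\to\mathbf{A}$ means there is a homomorphism, i.e. a map $h:X\to A$ with $h(\mathbf{x})\in R^{\mathbf{A}}$ for all $R\in\sigma$, $\mathbf{x}\in R^{\mathbf{X}}$. $\mathrm{CSP}(\mathbf{A})$ is the problem of deciding, for an input $\sigma$-structure $\mathbf{X}$, whether $\mathbf{X}\to\mathbf{A}$. For a tuple $\mathbf{x}$, $\{\mathbf{x}\}$ is its set of entries. $\mathcal{C}_{\mathbf{X}}$ is the set of formal expressions $R(\mathbf{x})$ with $\mathbf{x}\in R^{\mathbf{X}}$. Iterated degree and $\equiv_1$: the factor graph of $\mathbf{A}$ is the bipartite graph on $A\cup\mathcal{C}_{\mathbf{A}}$ with edges $\{a,R(\mathbf{a})\}$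 for $a\in\{\mathbf{a}\}$, labelled $(S,R)$ with $S=\{i:a_i=a\}$. $\delta^{\mathbf{A}}_0(v)$ is one fixed symbol for $v\in A$ and another for $v\in\mathcal{C}_{\mathbf{A}}$; for $j\ge1$, $\delta^{\mathbf{A}}_j(v)=\{\{(\ell_{\{v,w\}},\delta^{\mathbf{A}}_{j-1}(w)):w\text{ adjacent to }v\}\}$ where $\ell_{\{v,w\}}$ is the edge label; $\delta^{\mathbf{A}}(v)=(\delta^{\mathbf{A}}_j(v))_{j\ge0}$. $\mathbf{A}\equiv_1\mathbf{B}$ means $\{\{\delta^{\mathbf{A}}(v):v\in A\cup\mathcal{C}_{\mathbf{A}}\}\}=\{\{\delta^{\mathbf{B}}(v):v\in B\cup\mathcal{C}_{\mathbf{B}}\}\}$. $\mathrm{BLP}(\mathbf{X},\mathbf{A})$: variables $p_x(a)\in[0,1]$ ($x\in X,a\in A$) and $p_{R(\mathbf{x})}(\mathbf{a})\in[0,1]$ ($R(\mathbf{x})\in\mathcal{C}_{\mathbf{X}}$, $\mathbf{a}\in A^{\operatorname{ar}(R)}$), subject to $\sum_{a}p_x(a)=1$ for all $x$; $p_x(a)=\sum_{\mathbf{a}\in A^{\operatorname{ar}(R)},a_i=a}p_{R(\mathbf{x})}(\mathbf{a})$ for all $a\in A$, $R(\mathbf{x})\in\mathcal{C}_{\mathbf{X}}$, $i\in[\operatorname{ar}(R)]$ with $x_i=x$; and $p_{R(\mathbf{x})}(\mathbf{a})=0$ whenever $\mathbf{a}\notin R^{\mathbf{A}}$. $\mathrm{SA}^1(\mathbf{X},\mathbf{A})$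 is $\mathrm{BLP}(\mathbf{X},\mathbf{A})$ together with the additional constraints $p_{R(\mathbf{x})}(\mathbf{a})=0$ whenever there are $i,j$ with $x_i=x_j$ and $a_i\ne a_j$. A system is feasible if it has a rational solution; $\mathrm{L}\in\{\mathrm{BLP},\mathrm{SA}^1\}$ decides $\mathrm{CSP}(\mathbf{A})$ if for every $\sigma$-structure $\mathbf{X}$, feasibility of $\mathrm{L}(\mathbf{X},\mathbf{A})$ implies $\mathbf{X}\to\mathbf{A}$. A $k$-ary polymorphism of $\mathbf{A}$ is a map $f:A^k\to A$ such that for each $R\in\sigma$, applying $f$ coordinatewise to any $k$ tuples of $R^{\mathbf{A}}$ yields a tuple in $R^{\mathbf{A}}$; it is symmetric if $f(a_1,\dots,a_k)=f(a_{\rho(1)},\dots,a_{\rho(k)})$ for all $a_i$ and all permutations $\rho$ of $[k]$. -}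

module Defs where

open import Data.Nat using (ℕ; zero; suc)
open import Data.Bool using (Bool; true; false; T; if_then_else_; _∨_)
open import Data.Fin using (Fin; _≟_)
open import Data.Fin.Permutation using (Permutation′; _⟨$⟩ʳ_)
open import Data.Vec using (Vec; []; _∷_; lookup; tabulate; map; toList)
open import Data.List using (List; allFin; foldr)
import Data.List as List
open import Data.Product using (Σ; ∃; _×_; _,_; proj₁)
open import Data.Sum using (_⊎_; inj₁; inj₂)
open import Data.Rational using (ℚ; 0ℚ; 1ℚ; _+_; _≤_)
open import Relation.Nullary using (¬_)
open import Relation.Nullary.Decidable using (⌊_⌋)
open import Relation.Binary.PropositionalEquality using (_≡_)
open import Function.Bundles using (_↔_; Inverse)

record Signature : Set where
  field
    nsym : ℕ
    ar   : Fin nsym → ℕ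
open Signature public

record Structure (σ : Signature) : Set where
  field
    size     : ℕ
    rel      : (R : Fin (nsym σ)) → Vec (Fin size) (ar σ R) → Bool
    nonempty : (R : Fin (nsym σ)) → ∃ λ t → T (rel R t)
open Structure public

module _ {σ : Signature} where

  _⟶_ : Structure σ → Structure σ → Set
  X ⟶ A = Σ (Fin (size X) → Fin (size A)) λ h →
            (R : Fin (nsym σ)) (t : Vec (Fin (size X)) (ar σ R)) →
            T (rel X R t) → T (rel A R (map h t))

  Constraint : Structure σ → Set
  Constraint A = Σ (Fin (nsym σ)) λ R →
                 Σ (Vec (Fin (size A)) (ar σ R)) λ t → T (rel A R t)

  Node : Structure σ → Set
  Node A = Fin (size A) ⊎ Constraint A

  _∈ᵇ_ : ∀ {m k} → Fin m → Vec (Fin m) k → Bool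
  a ∈ᵇ []      = false
  a ∈ᵇ (b ∷ t) = ⌊ a ≟ b ⌋ ∨ (a ∈ᵇ t)

  -- edge labels (S , R), with S = {i : a_i = a} ⊆ [ar R] encoded as the
  -- list of its characteristic bits (its length is ar R, determined by R)
  Label : Set
  Label = Fin (nsym σ) × List Bool

  label : ∀ {m} (R : Fin (nsym σ)) → Vec (Fin m) (ar σ R) → Fin m → Label
  label R t a = R , toList (map (λ b → ⌊ b ≟ a ⌋) t)

  Adj : (A : Structure σ) → Node A → Set
  Adj A (inj₁ a)           = Σ (Constraint A) λ c → T (a ∈ᵇ proj₁ (Data.Product.proj₂ c))
  Adj A (inj₂ (R , t , _)) = Σ (Fin (size A)) λ a → T (a ∈ᵇ t)

  adjNode : (A : Structure σ) (v : Node A) → Adj A v → Node A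
  adjNode A (inj₁ a) (c , _)        = inj₂ c
  adjNode A (inj₂ (R , t , _)) (a , _) = inj₁ a

  adjLabel : (A : Structure σ) (v : Node A) → Adj A v → Label
  adjLabel A (inj₁ a) ((R , t , _) , _) = label R t a
  adjLabel A (inj₂ (R , t , _)) (a , _) = label R t a

  isVar : ∀ {A : Structure σ} → Node A → Bool
  isVar (inj₁ _) = true
  isVar (inj₂ _) = false

  -- SameDeg j v w  ⇔  δ^A_j(v) = δ^B_j(w).
  -- Equality of multisets {{(ℓ, δ_{j-1}(u))}} is written out as a bijection
  -- between the neighbourhoods preserving labels and δ_{j-1}.
  SameDeg : (A B : Structure σ) → ℕ → Node A → Node B → Set
  SameDeg A B zero    v w = isVar {A} v ≡ isVar {B} w
  SameDeg A B (suc j) v w =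
    Σ (Adj A v ↔ Adj B w) λ φ → (e : Adj A v) →
      (adjLabel A v e ≡ adjLabel B w (Inverse.to φ e)) ×
      SameDeg A B j (adjNode A v e) (adjNode B w (Inverse.to φ e))

  SameIteratedDeg : (A B : Structure σ) → Node A → Node B → Set
  SameIteratedDeg A B v w = (j : ℕ) → SameDeg A B j v w

  -- A ≡₁ B : the multisets {{δ^A(v)}} and {{δ^B(v)}} coincide, i.e. there
  -- is a bijection A ∪ C_A → B ∪ C_B preserving δ.
  _≡₁_ : Structure σ → Structure σ → Set
  A ≡₁ B = Σ (Node A ↔ Node B) λ φ → (v : Node A) →
             SameIteratedDeg A B v (Inverse.to φ v)

  sumFin : (m : ℕ) → (Fin m → ℚ) → ℚ
  sumFin m f = foldr _+_ 0ℚ (List.map f (allFin m))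

  sumTuples : (m k : ℕ) → (Vec (Fin m) k → ℚ) → ℚ
  sumTuples m zero    f = f []
  sumTuples m (suc k) f = sumFin m (λ a → sumTuples m k (λ t → f (a ∷ t)))

  record BLPSolution (X A : Structure σ) : Set where
    field
      pv : Fin (size X) → Fin (size A) → ℚ
      pc : (c : Constraint X) → Vec (Fin (size A)) (ar σ (proj₁ c)) → ℚ
      pv-range : ∀ x a → (0ℚ ≤ pv x a) × (pv x a ≤ 1ℚ)
      pc-range : ∀ c b → (0ℚ ≤ pc c b) × (pc c b ≤ 1ℚ)
      pv-sum   : ∀ x → sumFin (size A) (pv x) ≡ 1ℚ
      marginal : (c : Constraint X) (a : Fin (size A)) (i : Fin (ar σ (proj₁ c))) →
                 pv (lookup (proj₁ (Data.Product.proj₂ c)) i) a ≡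
                 sumTuples (size A) (ar σ (proj₁ c))
                   (λ b → if ⌊ lookup b i ≟ a ⌋ then pc c b else 0ℚ)
      support  : (c : Constraint X) (b : Vec (Fin (size A)) (ar σ (proj₁ c))) →
                 rel A (proj₁ c) b ≡ false → pc c b ≡ 0ℚ

  record SA1Solution (X A : Structure σ) : Set where
    field
      blp : BLPSolution X A
      consistent : (c : Constraint X) (b : Vec (Fin (size A)) (ar σ (proj₁ c)))
                   (i j : Fin (ar σ (proj₁ c))) →
                   lookup (proj₁ (Data.Product.proj₂ c)) i ≡
                     lookup (proj₁ (Data.Product.proj₂ c)) j →
                   ¬ (lookup b i ≡ lookup b j) →
                   BLPSolution.pc blp c b ≡ 0ℚ

  BLPDecides : Structure σ → Set
  BLPDecides A = (X : Structure σ) → BLPSolution X A → X ⟶ A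

  SA1Decides : Structure σ → Set
  SA1Decides A = (X : Structure σ) → SA1Solution X A → X ⟶ A

  CSPClosedUnder≡₁ : Structure σ → Set
  CSPClosedUnder≡₁ A = (X₁ X₂ : Structure σ) → X₁ ≡₁ X₂ →
                       ((X₁ ⟶ A) → (X₂ ⟶ A)) × ((X₂ ⟶ A) → (X₁ ⟶ A))

  IsPolymorphism : (A : Structure σ) (k : ℕ) → (Vec (Fin (size A)) k → Fin (size A)) → Set
  IsPolymorphism A k f =
    (R : Fin (nsym σ)) (ts : Vec (Vec (Fin (size A)) (ar σ R)) k) →
    ((j : Fin k) → T (rel A R (lookup ts j))) →
    T (rel A R (tabulate λ i → f (map (λ t → lookup t i) ts)))

  IsSymmetric : ∀ {m} (k : ℕ) → (Vec (Fin m) k → Fin m) → Set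
  IsSymmetric k f = (as : Vec _ k) (ρ : Permutation′ k) →
                    f as ≡ f (tabulate λ i → lookup as (ρ ⟨$⟩ʳ i))

  HasAllSymmetricPolymorphisms : Structure σ → Set
  HasAllSymmetricPolymorphisms A =
    (k : ℕ) → Σ (Vec (Fin (size A)) (suc k) → Fin (size A)) λ f →
      IsPolymorphism A (suc k) f × IsSymmetric (suc k) f

{-# OPTIONS --safe #-}
module Submission where

-- Symmetric polymorphisms ⇒ BLP.  With a common denominator D, a solution of BLP(X, A) assigns to
-- each variable a D-element multiset over A and to each constraint D tuples of A whose columns
-- enumerate the multisets of the entries.  A symmetric polymorphism of arity D maps multisets to
-- elements of A, and this is a homomorphism X ⟶ A.
--
-- SA¹ ⇒ closure under ≡₁.  Let X ≡₁ Y and g : X ⟶ A.  The stable colouring is an equitable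
-- partition, so averaging g over the colour class in X of each node of Y solves SA¹(Y, A).
--
-- Closure under ≡₁ ⇒ symmetric polymorphisms.  A k-ary symmetric polymorphism is a homomorphism
-- to A from the structure of k-element multisets, where multisets are related if they are the
-- columns of k tuples of A.  Replace each multiset by many copies and keep only the tuples with
-- distinct entries; call the result X.  By pigeonhole, X ⟶ A still suffices.  Now X has a twisted
-- k-fold covering which enumerates the multisets and so maps to A, and the twisted covering is
-- ≡₁-equivalent to the trivial covering, which contains a copy of X.

open import Defs
open import Data.Product using (_×_)
open import Function.Bundles using (_⇔_)

open import Axiom.UniquenessOfIdentityProofs using (module Decidable⇒UIP)
import Data.Bool as Bool
open import Data.Bool using (Bool; true; false; T; if_then_else_; _∧_)
open import Data.Bool.Properties using (T-∧; T-∨; T-irrelevant; T?)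
open import Data.Fin as Fin using (Fin; zero; suc; _↑ˡ_; _↑ʳ_; combine; remQuot; _≟_)
import Data.Fin.Properties as Fin
open import Data.Fin.Permutation as Perm using (Permutation′; _⟨$⟩ʳ_; _⟨$⟩ˡ_; inverseˡ; inverseʳ)
open import Data.Integer as ℤ using (-[1+_]) renaming (+_ to pos)
import Data.Integer.Properties as ℤ
open import Data.List as List using (List)
import Data.List.Properties as List
open import Data.Nat as ℕ using (ℕ; zero; suc; _+_; _*_; _≤_; _<_; z≤n; s≤s)
open import Data.Nat.Divisibility using (_∣_; divides; m∣m*n; ∣n⇒∣m*n)
import Data.Nat.Properties as ℕ
open import Data.Product as Product using (Σ; ∃; _,_; proj₁; proj₂)
open import Data.Product.Function.Dependent.Propositional using (Σ-↔)
import Data.Product.Properties as Product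
open import Data.Rational as ℚ using (ℚ; mkℚ; 0ℚ; 1ℚ; *≤*)
import Data.Rational.Properties as ℚ
open import Data.Rational.Unnormalised as ℚᵘ using (mkℚᵘ; *≡*; *≤*)
import Data.Rational.Unnormalised.Properties as ℚᵘ
open import Data.Sum using (_⊎_; inj₁; inj₂)
open import Data.Sum.Function.Propositional using (_⊎-↔_)
open import Data.Unit using (tt)
open import Data.Vec using (Vec; []; _∷_; lookup; tabulate; map; toList; replicate)
import Data.Vec.Properties as Vec
open import Function using (_∘_; case_of_; _↔_; Inverse; Equivalence; mk⇔; mk↔ₛ′)
open import Function.Properties.Inverse using (↔-refl; ↔-sym; ↔-trans)
open import Relation.Binary using (DecidableEquality)
open import Relation.Binary.PropositionalEquality
open import Relation.Nullary using (Dec; yes; no; does; ¬_; contradiction; Irrelevant)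
open import Relation.Nullary.Decidable as Dec using (map′; ⌊_⌋; toWitness; fromWitness; _×-dec_)

open import Algebra.Properties.Semiring.Sum ℕ.+-*-semiring
  using (sum; sum-cong-≗; sum-replicate-zero; ∑-comm; sum-permute; *-distribˡ-sum)

open Inverse using (to; from; strictlyInverseˡ; strictlyInverseʳ)

private variable
  S U : Set
  P Q : Set

-- Finite types and sums over them

record Finite (S : Set) : Set where
  field
    card : ℕ
    enum : Fin card ↔ S
open Finite public

private
  sum-mono : ∀ {n} {f g : Fin n → ℕ} → (∀ i → f i ≤ g i) → sum f ≤ sum g
  sum-mono {zero}  le = z≤n
  sum-mono {suc n} le = ℕ.+-mono-≤ (le zero) (sum-mono (le ∘ suc))

  sum-mono-< : ∀ {n} {f g : Fin n → ℕ} → (∀ i → f i ≤ g i) →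
               (i : Fin n) → f i < g i → sum f < sum g
  sum-mono-< le zero    lt = ℕ.+-mono-<-≤ lt (sum-mono (le ∘ suc))
  sum-mono-< le (suc i) lt = ℕ.+-mono-≤-< (le zero) (sum-mono-< (le ∘ suc) i lt)

  sum-++ : ∀ m {n} (f : Fin (m + n) → ℕ) → sum f ≡ sum (f ∘ (_↑ˡ n)) + sum (f ∘ (m ↑ʳ_))
  sum-++ zero    f = refl
  sum-++ (suc m) f = trans (cong (f zero +_) (sum-++ m (f ∘ suc))) (sym (ℕ.+-assoc (f zero) _ _))

private
  sum-≤ : ∀ {n} (f : Fin n → ℕ) (i : Fin n) → f i ≤ sum f
  sum-≤ f zero    = ℕ.m≤m+n _ _
  sum-≤ f (suc i) = ℕ.≤-trans (sum-≤ (f ∘ suc) i) (ℕ.m≤n+m _ (f zero))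

  sum-single : ∀ {n} (f : Fin n → ℕ) (i : Fin n) → (∀ j → j ≢ i → f j ≡ 0) → sum f ≡ f i
  sum-single {suc n} f zero    f≡0 = trans
    (cong (f zero +_) (trans (sum-cong-≗ (λ j → f≡0 (suc j) λ ())) (sum-replicate-zero n)))
    (ℕ.+-identityʳ _)
  sum-single {suc n} f (suc i) f≡0 = cong₂ _+_ (f≡0 zero λ ())
    (sum-single (f ∘ suc) i (λ j j≢i → f≡0 (suc j) (j≢i ∘ Fin.suc-injective)))

opaque
  ∑ : Finite S → (S → ℕ) → ℕ
  ∑ F f = sum (f ∘ to (enum F))

opaque
  -- The Iverson bracket, through which counting becomes summation.
  ⟦_⟧ : Dec P → ℕ
  ⟦ d ⟧ = if does d then 1 else 0

  ⟦⟧-yes : (d : Dec P) → P → ⟦ d ⟧ ≡ 1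
  ⟦⟧-yes (yes _) _ = refl
  ⟦⟧-yes (no ¬p) p = contradiction p ¬p

  ⟦⟧-no : (d : Dec P) → ¬ P → ⟦ d ⟧ ≡ 0
  ⟦⟧-no (yes p) ¬p = contradiction p ¬p
  ⟦⟧-no (no _)  _  = refl

  ⟦⟧-cong : (d : Dec P) (e : Dec Q) → (P → Q) → (Q → P) → ⟦ d ⟧ ≡ ⟦ e ⟧
  ⟦⟧-cong (yes p) e f g = sym (⟦⟧-yes e (f p))
  ⟦⟧-cong (no ¬p) e f g = sym (⟦⟧-no e (¬p ∘ g))

  ⟦⟧-mono : (d : Dec P) (e : Dec Q) → (P → Q) → ⟦ d ⟧ ≤ ⟦ e ⟧
  ⟦⟧-mono (yes p) e f = ℕ.≤-reflexive (sym (⟦⟧-yes e (f p)))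
  ⟦⟧-mono (no _)  e f = z≤n

  ⟦⟧-× : (d : Dec P) (e : Dec Q) → ⟦ d Dec.×-dec e ⟧ ≡ ⟦ d ⟧ * ⟦ e ⟧
  ⟦⟧-× (yes _) (yes _) = refl
  ⟦⟧-× (yes _) (no _)  = refl
  ⟦⟧-× (no _)  _       = refl

count : Finite S → {P : S → Set} → ((x : S) → Dec (P x)) → ℕ
count F P? = ∑ F (λ x → ⟦ P? x ⟧)

opaque
  unfolding ∑

  ∑-cong : (F : Finite S) {f g : S → ℕ} → (∀ x → f x ≡ g x) → ∑ F f ≡ ∑ F g
  ∑-cong F eq = sum-cong-≗ (eq ∘ to (enum F))

  ∑-zero : (F : Finite S) {f : S → ℕ} → (∀ x → f x ≡ 0) → ∑ F f ≡ 0
  ∑-zero F eq = trans (∑-cong F eq) (sum-replicate-zero (card F))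

  ∑-swap : (F : Finite S) (G : Finite U) (f : S → U → ℕ) →
           ∑ F (λ x → ∑ G (f x)) ≡ ∑ G (λ y → ∑ F (λ x → f x y))
  ∑-swap F G f = ∑-comm (λ i j → f (to (enum F) i) (to (enum G) j))

  ∑-*ˡ : (F : Finite S) (n : ℕ) (f : S → ℕ) → ∑ F (λ x → n * f x) ≡ n * ∑ F f
  ∑-*ˡ F n f = sym (*-distribˡ-sum n (f ∘ to (enum F)))

  ∑-*ʳ : (F : Finite S) (n : ℕ) (f : S → ℕ) → ∑ F (λ x → f x * n) ≡ ∑ F f * n
  ∑-*ʳ F n f = trans (∑-cong F (λ x → ℕ.*-comm (f x) n))
                     (trans (∑-*ˡ F n f) (ℕ.*-comm n _))

  -- Conjugating `φ` by the two enumerations reduces this to reindexing a sum over `Fin`. With `φ`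
  -- the identity it says that sums do not depend on the enumeration.
  ∑-↔ : (F : Finite S) (G : Finite U) (φ : S ↔ U) (f : U → ℕ) → ∑ G f ≡ ∑ F (f ∘ to φ)
  ∑-↔ F G φ f = trans
    (sum-permute (f ∘ to (enum G)) (↔-trans (↔-trans (enum F) φ) (↔-sym (enum G))))
    (sum-cong-≗ (λ i → cong f (strictlyInverseˡ (enum G) (to φ (to (enum F) i)))))

  ∑-mono : (F : Finite S) {f g : S → ℕ} → (∀ x → f x ≤ g x) → ∑ F f ≤ ∑ F g
  ∑-mono F le = sum-mono (le ∘ to (enum F))

  ∑-mono-< : (F : Finite S) {f g : S → ℕ} → (∀ x → f x ≤ g x) →
             (x : S) → f x < g x → ∑ F f < ∑ F g
  ∑-mono-< F {f} {g} le x lt = sum-mono-< (le ∘ to (enum F)) (from (enum F) x)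
    (subst (λ y → f y < g y) (sym (strictlyInverseˡ (enum F) x)) lt)

  ∑-≤ : (F : Finite S) (f : S → ℕ) (x : S) → f x ≤ ∑ F f
  ∑-≤ F f x = subst (λ y → f y ≤ ∑ F f) (strictlyInverseˡ (enum F) x)
                    (sum-≤ (f ∘ to (enum F)) (from (enum F) x))

  ∑-single : (F : Finite S) (f : S → ℕ) (x : S) → (∀ y → y ≢ x → f y ≡ 0) → ∑ F f ≡ f x
  ∑-single F f x f≡0 = trans
    (sum-single (f ∘ to (enum F)) (from (enum F) x)
       (λ j j≢ → f≡0 _ (λ eq → j≢ (trans (sym (strictlyInverseʳ (enum F) j)) (cong (from (enum F)) eq)))))
    (cong f (strictlyInverseˡ (enum F) x))

∑-count-≡ : (F : Finite S) (_≟_ : DecidableEquality S) (f : S → ℕ) (x : S) →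
            ∑ F (λ y → f y * ⟦ y ≟ x ⟧) ≡ f x
∑-count-≡ F _≟_ f x = trans
  (∑-single F _ x (λ y y≢x → trans (cong (f y *_) (⟦⟧-no (y ≟ x) y≢x)) (ℕ.*-zeroʳ (f y))))
  (trans (cong (f x *_) (⟦⟧-yes (x ≟ x) refl)) (ℕ.*-identityʳ (f x)))

opaque
  unfolding ∑

  ∑-const : (F : Finite S) (n : ℕ) → ∑ F (λ _ → n) ≡ card F * n
  ∑-const F n = sum-const (card F)
    where
    sum-const : ∀ m → sum {m} (λ _ → n) ≡ m * n
    sum-const zero    = refl
    sum-const (suc m) = cong (n +_) (sum-const m)

card≡∑ : (F : Finite S) → card F ≡ ∑ F (λ _ → 1)
card≡∑ F = sym (trans (∑-const F 1) (ℕ.*-identityʳ _))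

any? : (F : Finite S) {P : S → Set} → (∀ x → Dec (P x)) → Dec (∃ P)
any? F {P} P? = map′
  (λ (i , p) → to (enum F) i , p)
  (λ (x , p) → from (enum F) x , subst P (sym (strictlyInverseˡ (enum F) x)) p)
  (Fin.any? (P? ∘ to (enum F)))

all? : (F : Finite S) {P : S → Set} → (∀ x → Dec (P x)) → Dec (∀ x → P x)
all? F {P} P? = map′
  (λ p x → subst P (strictlyInverseˡ (enum F) x) (p (from (enum F) x)))
  (λ p → p ∘ to (enum F))
  (Fin.all? (P? ∘ to (enum F)))

count-pos : (F : Finite S) {P : S → Set} (P? : ∀ x → Dec (P x)) (x : S) → P x → 1 ≤ count F P?
count-pos F P? x p = ℕ.≤-trans (ℕ.≤-reflexive (sym (⟦⟧-yes (P? x) p))) (∑-≤ F (λ x → ⟦ P? x ⟧) x)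

count-witness : (F : Finite S) {P : S → Set} (P? : ∀ x → Dec (P x)) → 1 ≤ count F P? → ∃ P
count-witness F P? 1≤ with any? F P?
... | yes p = p
... | no ¬p = contradiction (∑-zero F (λ x → ⟦⟧-no (P? x) (λ p → ¬p (x , p)))) (ℕ.m<n⇒n≢0 1≤)

-- Constructions of finite types

fin : ∀ {n} → Finite (Fin n)
fin .card = _
fin .enum = ↔-refl

opaque
  unfolding ∑

  ∑-Fin-zero : (f : Fin 0 → ℕ) → ∑ fin f ≡ 0
  ∑-Fin-zero f = refl

  ∑-Fin-suc : ∀ {n} (f : Fin (suc n) → ℕ) → ∑ fin f ≡ f zero + ∑ fin (f ∘ suc)
  ∑-Fin-suc f = refl

mapFinite : S ↔ U → Finite S → Finite U
mapFinite φ F .card = card F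
mapFinite φ F .enum = ↔-trans (enum F) φ

opaque
  unfolding ⟦_⟧

  -- A proposition with at most one proof has its Iverson bracket as cardinality. Combined with
  -- `finiteΣ` this makes decidable subtypes finite.
  finiteDec : (d : Dec P) → Irrelevant P → Finite P
  finiteDec d irr .card = ⟦ d ⟧
  finiteDec (yes p) irr .enum = mk↔ₛ′ (λ _ → p) (λ _ → zero) (irr p) (λ { zero → refl })
  finiteDec (no ¬p) irr .enum = mk↔ₛ′ (λ ()) (λ p → contradiction p ¬p) (λ p → contradiction p ¬p) (λ ())

  card-finiteDec : (d : Dec P) (irr : Irrelevant P) → card (finiteDec d irr) ≡ ⟦ d ⟧
  card-finiteDec (yes _) irr = refl
  card-finiteDec (no _)  irr = refl

opaque
  unfolding ∑

  finite⊎ : Finite S → Finite U → Finite (S ⊎ U)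
  finite⊎ F G .card = card F + card G
  finite⊎ F G .enum = ↔-trans Fin.+↔⊎ (enum F ⊎-↔ enum G)

  ∑-⊎ : (F : Finite S) (G : Finite U) (f : S ⊎ U → ℕ) →
        ∑ (finite⊎ F G) f ≡ ∑ F (f ∘ inj₁) + ∑ G (f ∘ inj₂)
  ∑-⊎ F G f = trans (sum-++ (card F) _) (cong₂ _+_
    (sum-cong-≗ (λ i → cong (f ∘ to (enum F ⊎-↔ enum G)) (Fin.splitAt-↑ˡ (card F) i (card G))))
    (sum-cong-≗ (λ i → cong (f ∘ to (enum F ⊎-↔ enum G)) (Fin.splitAt-↑ʳ (card F) (card G) i))))

  private
    Σ-suc : ∀ {n} {B : Fin (suc n) → Set} → (B zero ⊎ Σ (Fin n) (B ∘ suc)) ↔ Σ (Fin (suc n)) B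
    Σ-suc = mk↔ₛ′
      (λ { (inj₁ b) → zero , b ; (inj₂ (i , b)) → suc i , b })
      (λ { (zero , b) → inj₁ b ; (suc i , b) → inj₂ (i , b) })
      (λ { (zero , b) → refl ; (suc i , b) → refl })
      (λ { (inj₁ b) → refl ; (inj₂ (i , b)) → refl })

    finiteΣFin : ∀ n {B : Fin n → Set} → (∀ i → Finite (B i)) → Finite (Σ (Fin n) B)
    finiteΣFin zero    FB .card = 0
    finiteΣFin zero    FB .enum = mk↔ₛ′ (λ ()) (λ ()) (λ ()) (λ ())
    finiteΣFin (suc n) FB = mapFinite Σ-suc (finite⊎ (FB zero) (finiteΣFin n (FB ∘ suc)))

    ∑-ΣFin : ∀ n {B : Fin n → Set} (FB : ∀ i → Finite (B i)) (f : Σ (Fin n) B → ℕ) →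
             ∑ (finiteΣFin n FB) f ≡ sum (λ i → ∑ (FB i) (λ b → f (i , b)))
    ∑-ΣFin zero    FB f = refl
    ∑-ΣFin (suc n) FB f = trans
      (∑-⊎ (FB zero) (finiteΣFin n (FB ∘ suc)) (f ∘ to Σ-suc))
      (cong (∑ (FB zero) (λ b → f (zero , b)) +_) (∑-ΣFin n (FB ∘ suc) (λ (i , b) → f (suc i , b))))

  finiteΣ : {B : S → Set} → Finite S → (∀ x → Finite (B x)) → Finite (Σ S B)
  finiteΣ F FB = mapFinite (Σ-↔ (enum F) ↔-refl) (finiteΣFin (card F) (FB ∘ to (enum F)))

  ∑-Σ : {B : S → Set} (F : Finite S) (FB : ∀ x → Finite (B x)) (f : Σ S B → ℕ) →
        ∑ (finiteΣ F FB) f ≡ ∑ F (λ x → ∑ (FB x) (λ b → f (x , b)))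
  ∑-Σ F FB f = ∑-ΣFin (card F) (FB ∘ to (enum F)) (λ (i , b) → f (to (enum F) i , b))

finite× : Finite S → Finite U → Finite (S × U)
finite× F G = finiteΣ F (λ _ → G)

opaque
  finiteVec : Finite S → ∀ n → Finite (Vec S n)
  finiteVec F zero    .card = 1
  finiteVec F zero    .enum = mk↔ₛ′ (λ _ → []) (λ _ → zero) (λ { [] → refl }) (λ { zero → refl })
  finiteVec F (suc n) = mapFinite
    (mk↔ₛ′ (λ (x , xs) → x ∷ xs) (λ { (x ∷ xs) → x , xs }) (λ { (x ∷ xs) → refl }) (λ { (x , xs) → refl }))
    (finite× F (finiteVec F n))

  ∑-Vec-[] : (F : Finite S) (f : Vec S 0 → ℕ) → ∑ (finiteVec F 0) f ≡ f []
  ∑-Vec-[] F f = ∑-single (finiteVec F 0) f [] (λ { [] []≢[] → contradiction refl []≢[] })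

  ∑-Vec-∷ : (F : Finite S) (n : ℕ) (f : Vec S (suc n) → ℕ) →
            ∑ (finiteVec F (suc n)) f ≡ ∑ F (λ x → ∑ (finiteVec F n) (λ xs → f (x ∷ xs)))
  ∑-Vec-∷ F n f = trans
    (∑-↔ (finite× F (finiteVec F n)) (finiteVec F (suc n))
      (mk↔ₛ′ (λ (x , xs) → x ∷ xs) (λ { (x ∷ xs) → x , xs }) (λ { (x ∷ xs) → refl }) (λ { (x , xs) → refl }))
      f)
    (∑-Σ F (λ _ → finiteVec F n) (λ (x , xs) → f (x ∷ xs)))

card-Σ : {B : S → Set} (F : Finite S) (FB : ∀ x → Finite (B x)) →
         card (finiteΣ F FB) ≡ ∑ F (card ∘ FB)
card-Σ F FB = trans (card≡∑ (finiteΣ F FB))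
  (trans (∑-Σ F FB (λ _ → 1)) (∑-cong F (sym ∘ card≡∑ ∘ FB)))

card≡⇒↔ : (F : Finite S) (G : Finite U) → card F ≡ card G → S ↔ U
card≡⇒↔ F G eq = ↔-trans (↔-sym (enum F)) (subst (λ n → Fin n ↔ _) (sym eq) (enum G))

-- Families of elements of a type with decidable equality

module _ {A : Set} (_≟_ : DecidableEquality A) where

  private
    Fibre : (S → A) → A → Set
    Fibre u a = ∃ λ j → u j ≡ a

    finiteFibre : Finite S → (u : S → A) (a : A) → Finite (Fibre u a)
    finiteFibre F u a = finiteΣ F (λ j → finiteDec (u j ≟ a) (Decidable⇒UIP.≡-irrelevant _≟_))

    fibres : (u : S → A) → S ↔ Σ A (Fibre u)
    fibres u = mk↔ₛ′ (λ j → u j , j , refl) (proj₁ ∘ proj₂) (λ { (a , j , refl) → refl }) (λ _ → refl)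

  multiplicity : Finite S → (S → A) → A → ℕ
  multiplicity F u a = count F (λ j → u j ≟ a)

  private
    card-fibre : (F : Finite S) (u : S → A) (a : A) → card (finiteFibre F u a) ≡ multiplicity F u a
    card-fibre F u a = trans (card-Σ F _) (∑-cong F (λ j → card-finiteDec (u j ≟ a) _))

  -- Each family splits its index type into fibres over `A`. Fibres over the same element have equal
  -- cardinality, and bijections between them glue together. This is how equality of multisets
  -- becomes a permutation.
  multiplicity≗⇒↔ : (F : Finite S) (G : Finite U) (u : S → A) (v : U → A) →
                    (∀ a → multiplicity F u a ≡ multiplicity G v a) →
                    Σ (S ↔ U) λ ρ → ∀ j → v (to ρ j) ≡ u j
  multiplicity≗⇒↔ F G u v eq =
    ↔-trans (fibres u) (↔-trans (Σ-↔ ↔-refl fibre↔) (↔-sym (fibres v))) ,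
    λ j → proj₂ (to fibre↔ (j , refl))
    where
    fibre↔ : ∀ {a} → Fibre u a ↔ Fibre v a
    fibre↔ {a} = card≡⇒↔ (finiteFibre F u a) (finiteFibre G v a)
      (trans (card-fibre F u a) (trans (eq a) (sym (card-fibre G v a))))

  multiplicity-↔ : (F : Finite S) (G : Finite U) (ρ : S ↔ U) (u : S → A) (v : U → A) →
                   (∀ j → v (to ρ j) ≡ u j) → ∀ a → multiplicity F u a ≡ multiplicity G v a
  multiplicity-↔ F G ρ u v eq a = sym (trans (∑-↔ F G ρ _)
    (∑-cong F (λ j → cong (λ b → ⟦ b ≟ a ⟧) (eq j))))

  -- If every fibre of `g` had fewer than `r` elements, adding up the fibres would give at most
  -- `card FA * r` elements. The map `e` lists the first `r` elements of a large fibre.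
  pigeonhole : (F : Finite S) (FA : Finite A) (g : S → A) (r : ℕ) → card FA * r < card F →
               ∃ λ a → Σ (Fin r → S) λ e →
                 (∀ i → g (e i) ≡ a) × (∀ i j → e i ≡ e j → i ≡ j)
  pigeonhole F FA g r lt with any? FA (λ a → r ℕ.≤? multiplicity F g a)
  ... | yes (a , r≤) = a , proj₁ ∘ e , proj₂ ∘ e , e-injective
    where
    FF = finiteFibre F g a
    r≤′ = ℕ.≤-trans r≤ (ℕ.≤-reflexive (sym (card-fibre F g a)))
    e : Fin r → Fibre g a
    e i = to (enum FF) (Fin.inject≤ i r≤′)
    fibre-≡ : {x y : Fibre g a} → proj₁ x ≡ proj₁ y → x ≡ y
    fibre-≡ refl = cong (_ ,_) (Decidable⇒UIP.≡-irrelevant _≟_ _ _)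
    e-injective : ∀ i j → proj₁ (e i) ≡ proj₁ (e j) → i ≡ j
    e-injective i j eq = Fin.inject≤-injective r≤′ r≤′ i j
      (trans (sym (strictlyInverseʳ (enum FF) _))
        (trans (cong (from (enum FF)) (fibre-≡ eq)) (strictlyInverseʳ (enum FF) _)))
  ... | no ¬p = contradiction lt (ℕ.≤⇒≯ (begin
    card F                                   ≡⟨ card≡∑ F ⟩
    ∑ F (λ _ → 1)                            ≡⟨ ∑-cong F (λ j → sym (∑-count-g j)) ⟩
    ∑ F (λ j → ∑ FA (λ a → ⟦ g j ≟ a ⟧))     ≡⟨ ∑-swap F FA _ ⟩
    ∑ FA (multiplicity F g)                  ≤⟨ ∑-mono FA (λ a → ℕ.≰⇒≥ (λ r≤ → ¬p (a , r≤))) ⟩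
    ∑ FA (λ _ → r)                           ≡⟨ ∑-const FA r ⟩
    card FA * r                              ∎))
    where
    open ℕ.≤-Reasoning
    ∑-count-g : ∀ j → ∑ FA (λ a → ⟦ g j ≟ a ⟧) ≡ 1
    ∑-count-g j = trans
      (∑-single FA _ (g j) (λ a a≢ → ⟦⟧-no (g j ≟ a) (a≢ ∘ sym)))
      (⟦⟧-yes (g j ≟ g j) refl)

-- The family enumerates `Σ A (Fin ∘ m)`, where each `a` occurs `m a` times. The arbitrary weight
-- `w` allows counting by any property of `a`; for tuples, by the value of a single entry.
realise : {A : Set} (FA : Finite A) (m : A → ℕ) {D : ℕ} → ∑ FA m ≡ D →
          Σ (Fin D → A) λ g → (∀ w → ∑ fin (w ∘ g) ≡ ∑ FA (λ a → m a * w a)) ×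
                              (∀ j → m (g j) ≢ 0)
realise {A} FA m {D} ∑m≡D = proj₁ ∘ to φ , sums , λ j → ℕ.m<n⇒n≢0 (Fin.toℕ<n (proj₂ (to φ j)))
  where
  F : Finite (Σ A (Fin ∘ m))
  F = finiteΣ FA (λ a → fin {m a})
  φ : Fin D ↔ Σ A (Fin ∘ m)
  φ = card≡⇒↔ fin F (sym (trans (card-Σ FA (λ a → fin {m a})) ∑m≡D))
  sums : ∀ w → ∑ fin (w ∘ proj₁ ∘ to φ) ≡ ∑ FA (λ a → m a * w a)
  sums w = begin
    ∑ fin (w ∘ proj₁ ∘ to φ)            ≡⟨ ∑-↔ fin F φ (w ∘ proj₁) ⟨
    ∑ F (w ∘ proj₁)                     ≡⟨ ∑-Σ FA (λ a → fin {m a}) (w ∘ proj₁) ⟩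
    ∑ FA (λ a → ∑ (fin {m a}) (λ _ → w a)) ≡⟨ ∑-cong FA (λ a → ∑-const (fin {m a}) (w a)) ⟩
    ∑ FA (λ a → m a * w a)              ∎
    where open ≡-Reasoning

-- Extensionality for vectors, decisions and subtypes

vec-ext : {S : Set} {n : ℕ} {s t : Vec S n} → (∀ i → lookup s i ≡ lookup t i) → s ≡ t
vec-ext {s = s} {t} eq = trans (sym (Vec.tabulate∘lookup s))
  (trans (Vec.tabulate-cong eq) (Vec.tabulate∘lookup t))

⌊⌋-cong : {P Q : Set} (d : Dec P) (e : Dec Q) → (P → Q) → (Q → P) → ⌊ d ⌋ ≡ ⌊ e ⌋
⌊⌋-cong (yes _) (yes _) f g = refl
⌊⌋-cong (yes p) (no ¬q) f g = contradiction (f p) ¬q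
⌊⌋-cong (no ¬p) (yes q) f g = contradiction (g q) ¬p
⌊⌋-cong (no _)  (no _)  f g = refl

Σ-≡ : {S : Set} {B : S → Set} → (∀ {x} → Irrelevant (B x)) → {x y : Σ S B} → proj₁ x ≡ proj₁ y → x ≡ y
Σ-≡ irr refl = cong (_ ,_) (irr _ _)

-- Entries of tuples and iterated degrees

module _ {σ : Signature} where

  lookup∈ : ∀ {m k} (t : Vec (Fin m) k) (i : Fin k) → T (_∈ᵇ_ {σ} (lookup t i) t)
  lookup∈ (b ∷ t) zero    = Equivalence.from T-∨ (inj₁ (fromWitness {a? = b ≟ b} refl))
  lookup∈ (b ∷ t) (suc i) = Equivalence.from T-∨ (inj₂ (lookup∈ t i))

  ∈⇒lookup : ∀ {m k} {a : Fin m} (t : Vec (Fin m) k) → T (_∈ᵇ_ {σ} a t) → ∃ λ i → lookup t i ≡ a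
  ∈⇒lookup {a = a} (b ∷ t) a∈ with Equivalence.to (T-∨ {⌊ a ≟ b ⌋}) a∈
  ... | inj₁ a≡b = zero , sym (toWitness a≡b)
  ... | inj₂ a∈t = Product.map suc (λ eq → eq) (∈⇒lookup t a∈t)

  sameDeg-sym : ∀ {A B : Structure σ} j {v w} → SameDeg A B j v w → SameDeg B A j w v
  sameDeg-sym zero    eq      = sym eq
  sameDeg-sym {A} {B} (suc j) {v} {w} (φ , pres) = ↔-sym φ , λ e →
    let eq , same = pres (from φ e) in
    subst (λ e′ → (adjLabel B w e′ ≡ adjLabel A v (from φ e)) ×
                  SameDeg B A j (adjNode B w e′) (adjNode A v (from φ e)))
          (strictlyInverseˡ φ e) (sym eq , sameDeg-sym j same)

  sameDeg-trans : ∀ {A B C : Structure σ} j {u v w} →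
                  SameDeg A B j u v → SameDeg B C j v w → SameDeg A C j u w
  sameDeg-trans zero    eq eq′ = trans eq eq′
  sameDeg-trans (suc j) (φ , pres) (ψ , pres′) = ↔-trans φ ψ , λ e →
    let eq , same = pres e ; eq′ , same′ = pres′ (to φ e) in
    trans eq eq′ , sameDeg-trans j same same′

  ≡₁-sym : {A B : Structure σ} → A ≡₁ B → B ≡₁ A
  ≡₁-sym {A} {B} (φ , same) = ↔-sym φ , λ w j → sameDeg-sym j
    (subst (SameDeg A B j (from φ w)) (strictlyInverseˡ φ w) (same (from φ w) j))

  constraint-≡ : (A : Structure σ) {R : Fin (nsym σ)} {s t : Vec (Fin (size A)) (ar σ R)}
                 {p : T (rel A R s)} {q : T (rel A R t)} → s ≡ t →
                 _≡_ {A = Constraint A} (R , s , p) (R , t , q)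
  constraint-≡ A refl = cong (λ p → _ , _ , p) (T-irrelevant _ _)

  -- Coverings with fibre Fin (suc k), twisted by permutations

  Twist : Structure σ → ℕ → Set
  Twist X k = (R : Fin (nsym σ)) → Vec (Fin (size X)) (ar σ R) → Fin (ar σ R) → Permutation′ (suc k)

  module Covering (X : Structure σ) (k : ℕ)
    (distinct : ∀ R t → T (rel X R t) → ∀ i j → lookup t i ≡ lookup t j → i ≡ j) where

    Point : Set
    Point = Fin (size X * suc k)

    opaque
      base : Point → Fin (size X)
      base y = proj₁ (remQuot {size X} (suc k) y)

      sheet : Point → Fin (suc k)
      sheet y = proj₂ (remQuot {size X} (suc k) y)

      point : Fin (size X) → Fin (suc k) → Point
      point = combine

      base-point : ∀ x s → base (point x s) ≡ x
      base-point x s = cong proj₁ (Fin.remQuot-combine x s)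

      sheet-point : ∀ x s → sheet (point x s) ≡ s
      sheet-point x s = cong proj₂ (Fin.remQuot-combine x s)

      point-base-sheet : ∀ y → point (base y) (sheet y) ≡ y
      point-base-sheet = Fin.combine-remQuot {size X} (suc k)

    Tuple : Fin (nsym σ) → Set
    Tuple R = Vec (Fin (size X)) (ar σ R)

    module _ (π : Twist X k) where

      -- The number `j` for which entry `i` of `u` agrees with entry `i` of `lift R t j`. A tuple
      -- over `t` is a lift of `t` when all its entries give the same number.
      index : ∀ R → Tuple R → Vec Point (ar σ R) → Fin (ar σ R) → Fin (suc k)
      index R t u i = π R t i ⟨$⟩ˡ sheet (lookup u i)

      Consistent : ∀ R → Tuple R → Vec Point (ar σ R) → Set
      Consistent R t u = ∀ i j → index R t u i ≡ index R t u j

      consistent? : ∀ R t u → Dec (Consistent R t u)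
      consistent? R t u = Fin.all? λ i → Fin.all? λ j → index R t u i ≟ index R t u j

      coverRel : ∀ R → Vec Point (ar σ R) → Bool
      coverRel R u = rel X R (map base u) ∧ ⌊ consistent? R (map base u) u ⌋

      coverRel⁻ : ∀ R u → T (coverRel R u) → T (rel X R (map base u)) × Consistent R (map base u) u
      coverRel⁻ R u p = Product.map₂ toWitness (Equivalence.to (T-∧ {rel X R (map base u)}) p)

      lift : ∀ R → Tuple R → Fin (suc k) → Vec Point (ar σ R)
      lift R t j = tabulate (λ i → point (lookup t i) (π R t i ⟨$⟩ʳ j))

      lookup-lift : ∀ R t j i → lookup (lift R t j) i ≡ point (lookup t i) (π R t i ⟨$⟩ʳ j)
      lookup-lift R t j i = Vec.lookup∘tabulate _ i

      map-base-lift : ∀ R t j → map base (lift R t j) ≡ t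
      map-base-lift R t j = vec-ext λ i → begin
        lookup (map base (lift R t j)) i            ≡⟨ Vec.lookup-map i base (lift R t j) ⟩
        base (lookup (lift R t j) i)                ≡⟨ cong base (lookup-lift R t j i) ⟩
        base (point (lookup t i) (π R t i ⟨$⟩ʳ j))  ≡⟨ base-point _ _ ⟩
        lookup t i                                  ∎
        where open ≡-Reasoning

      index-lift : ∀ R t j i → index R t (lift R t j) i ≡ j
      index-lift R t j i = begin
        π R t i ⟨$⟩ˡ sheet (lookup (lift R t j) i)
          ≡⟨ cong (λ y → π R t i ⟨$⟩ˡ sheet y) (lookup-lift R t j i) ⟩
        π R t i ⟨$⟩ˡ sheet (point (lookup t i) (π R t i ⟨$⟩ʳ j))
          ≡⟨ cong (π R t i ⟨$⟩ˡ_) (sheet-point _ _) ⟩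
        π R t i ⟨$⟩ˡ (π R t i ⟨$⟩ʳ j)
          ≡⟨ inverseˡ (π R t i) ⟩
        j ∎
        where open ≡-Reasoning

      coverRel⁺ : ∀ R t u → map base u ≡ t → T (rel X R t) → Consistent R t u → T (coverRel R u)
      coverRel⁺ R _ u refl p c = Equivalence.from T-∧ (p , fromWitness c)

      lift-rel : ∀ R t j → T (rel X R t) → T (coverRel R (lift R t j))
      lift-rel R t j p = coverRel⁺ R t (lift R t j) (map-base-lift R t j) p
        (λ i i′ → trans (index-lift R t j i) (sym (index-lift R t j i′)))

      lift-index : ∀ R t u → map base u ≡ t → Consistent R t u → ∀ p → lift R t (index R t u p) ≡ u
      lift-index R _ u refl c p = vec-ext λ i → let ρ = π R (map base u) i in begin
        lookup (lift R (map base u) (index R (map base u) u p)) i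
          ≡⟨ lookup-lift R (map base u) _ i ⟩
        point (lookup (map base u) i) (ρ ⟨$⟩ʳ index R (map base u) u p)
          ≡⟨ cong₂ point (Vec.lookup-map i base u) (cong (ρ ⟨$⟩ʳ_) (c p i)) ⟩
        point (base (lookup u i)) (ρ ⟨$⟩ʳ (ρ ⟨$⟩ˡ sheet (lookup u i)))
          ≡⟨ cong (point _) (inverseʳ ρ) ⟩
        point (base (lookup u i)) (sheet (lookup u i))
          ≡⟨ point-base-sheet (lookup u i) ⟩
        lookup u i ∎
        where open ≡-Reasoning

      cover : Structure σ
      cover .size       = size X * suc k
      cover .rel        = coverRel
      cover .nonempty R = let t , p = nonempty X R in lift R t zero , lift-rel R t zero p

      -- Constraints of the cover are determined by their base and any one of their entries,
      -- because the entries of the base are distinct.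
      project : Node cover → Node X
      project (inj₁ y)           = inj₁ (base y)
      project (inj₂ (R , u , p)) = inj₂ (R , map base u , proj₁ (coverRel⁻ R u p))

      base∈ : ∀ {n y} (u : Vec Point n) → T (_∈ᵇ_ {σ} y u) → T (_∈ᵇ_ {σ} (base y) (map base u))
      base∈ {y = y} u y∈ = let i , eq = ∈⇒lookup u y∈ in
        subst (λ x → T (_∈ᵇ_ {σ} x (map base u)))
              (trans (Vec.lookup-map i base u) (cong base eq)) (lookup∈ (map base u) i)

      base-injective : ∀ R u → T (coverRel R u) → ∀ i j → base (lookup u i) ≡ base (lookup u j) → i ≡ j
      base-injective R u p i j eq = distinct R (map base u) (proj₁ (coverRel⁻ R u p)) i j
        (trans (Vec.lookup-map i base u) (trans eq (sym (Vec.lookup-map j base u))))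

      -- A label records the positions of its element. Positions of `u` over the same base element
      -- coincide, so projecting adds no position to the label.
      label-base : ∀ R u → T (coverRel R u) → ∀ y → T (_∈ᵇ_ {σ} y u) →
                   label {σ} R u y ≡ label {σ} R (map base u) (base y)
      label-base R u p y y∈ = cong (λ bs → R , toList bs) (vec-ext λ i → begin
        lookup (map (λ b → ⌊ b ≟ y ⌋) u) i
          ≡⟨ Vec.lookup-map i _ u ⟩
        ⌊ lookup u i ≟ y ⌋
          ≡⟨ ⌊⌋-cong (lookup u i ≟ y) (base (lookup u i) ≟ base y) (cong base) (λ eq →
               let j , uj≡y = ∈⇒lookup u y∈ in
               trans (cong (lookup u) (base-injective R u p i j (trans eq (cong base (sym uj≡y))))) uj≡y) ⟩
        ⌊ base (lookup u i) ≟ base y ⌋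
          ≡⟨ cong (λ x → ⌊ x ≟ base y ⌋) (Vec.lookup-map i base u) ⟨
        ⌊ lookup (map base u) i ≟ base y ⌋
          ≡⟨ Vec.lookup-map i _ (map base u) ⟨
        lookup (map (λ b → ⌊ b ≟ base y ⌋) (map base u)) i ∎)
        where open ≡-Reasoning

      -- Neighbourhoods correspond bijectively, so `project` is a covering map of factor graphs.
      adj-project : ∀ v → Adj cover v ↔ Adj X (project v)
      adj-project (inj₁ y) = mk↔ₛ′ down up down-up up-down
        where
        down : Adj cover (inj₁ y) → Adj X (inj₁ (base y))
        down ((R , u , p) , y∈) = (R , map base u , proj₁ (coverRel⁻ R u p)) , base∈ u y∈
        up : Adj X (inj₁ (base y)) → Adj cover (inj₁ y)
        up ((R , t , p) , x∈) =
          let i , eq = ∈⇒lookup t x∈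
              j      = π R t i ⟨$⟩ˡ sheet y
          in (R , lift R t j , lift-rel R t j p) ,
             subst (λ z → T (_∈ᵇ_ {σ} z (lift R t j)))
               (trans (lookup-lift R t j i)
                 (trans (cong₂ point eq (inverseʳ (π R t i))) (point-base-sheet y)))
               (lookup∈ (lift R t j) i)
        down-up : ∀ e → down (up e) ≡ e
        down-up ((R , t , p) , x∈) = Σ-≡ T-irrelevant (constraint-≡ X (map-base-lift R t _))
        up-down : ∀ e → up (down e) ≡ e
        up-down ((R , u , p) , y∈) =
          let i , eq   = ∈⇒lookup (map base u) (base∈ u y∈)
              j , uj≡y = ∈⇒lookup u y∈
              q , c    = coverRel⁻ R u p
              -- The position found in the base and the one found in `u` come from separate
              -- searches; distinctness of the entries identifies them.
              i≡j      = base-injective R u p i j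
                           (trans (sym (Vec.lookup-map i base u)) (trans eq (cong base (sym uj≡y))))
          in Σ-≡ T-irrelevant (constraint-≡ cover (trans
               (cong (λ z → lift R (map base u) (π R (map base u) i ⟨$⟩ˡ sheet z))
                 (trans (sym uj≡y) (cong (lookup u) (sym i≡j))))
               (lift-index R (map base u) u refl c i)))
      adj-project (inj₂ (R , u , p)) = mk↔ₛ′ down up down-up up-down
        where
        down : Adj cover (inj₂ (R , u , p)) → Adj X (project (inj₂ (R , u , p)))
        down (y , y∈) = base y , base∈ u y∈
        up : Adj X (project (inj₂ (R , u , p))) → Adj cover (inj₂ (R , u , p))
        up (x , x∈) = let i , _ = ∈⇒lookup (map base u) x∈ in lookup u i , lookup∈ u i
        down-up : ∀ e → down (up e) ≡ e
        down-up (x , x∈) = let i , eq = ∈⇒lookup (map base u) x∈ in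
          Σ-≡ T-irrelevant (trans (sym (Vec.lookup-map i base u)) eq)
        up-down : ∀ e → up (down e) ≡ e
        up-down (y , y∈) =
          let i , eq   = ∈⇒lookup (map base u) (base∈ u y∈)
              j , uj≡y = ∈⇒lookup u y∈
          in Σ-≡ T-irrelevant (trans (cong (lookup u) (base-injective R u p i j
               (trans (sym (Vec.lookup-map i base u)) (trans eq (cong base (sym uj≡y)))))) uj≡y)

      -- Covering maps preserve iterated degrees, by induction along the label-preserving bijections
      -- of neighbourhoods.
      sameDeg-project : ∀ j v → SameDeg cover X j v (project v)
      sameDeg-project zero    (inj₁ _) = refl
      sameDeg-project zero    (inj₂ _) = refl
      sameDeg-project (suc j) (inj₁ y) = adj-project (inj₁ y) , λ where
        ((R , u , p) , y∈) → label-base R u p y y∈ , sameDeg-project j (inj₂ (R , u , p))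
      sameDeg-project (suc j) (inj₂ (R , u , p)) = adj-project (inj₂ (R , u , p)) , λ where
        (y , y∈) → label-base R u p y y∈ , sameDeg-project j (inj₁ y)

    module _ (π π′ : Twist X k) where

      -- On constraints, the `π`-lift with index `j` goes to the `π′`-lift of the same base tuple
      -- with the same index.
      retwist : ∀ R → Vec Point (ar σ R) → Vec Point (ar σ R)
      retwist R u = tabulate λ i →
        point (base (lookup u i)) (π′ R (map base u) i ⟨$⟩ʳ index π R (map base u) u i)

      lookup-retwist : ∀ R u i → lookup (retwist R u) i ≡
                       point (base (lookup u i)) (π′ R (map base u) i ⟨$⟩ʳ index π R (map base u) u i)
      lookup-retwist R u i = Vec.lookup∘tabulate _ i

      map-base-retwist : ∀ R u → map base (retwist R u) ≡ map base u
      map-base-retwist R u = vec-ext λ i → begin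
        lookup (map base (retwist R u)) i  ≡⟨ Vec.lookup-map i base (retwist R u) ⟩
        base (lookup (retwist R u) i)      ≡⟨ cong base (lookup-retwist R u i) ⟩
        base (point _ _)                   ≡⟨ base-point _ _ ⟩
        base (lookup u i)                  ≡⟨ Vec.lookup-map i base u ⟨
        lookup (map base u) i              ∎
        where open ≡-Reasoning

      index-retwist : ∀ R u i → index π′ R (map base u) (retwist R u) i ≡ index π R (map base u) u i
      index-retwist R u i = begin
        π′ R (map base u) i ⟨$⟩ˡ sheet (lookup (retwist R u) i)
          ≡⟨ cong (λ y → π′ R (map base u) i ⟨$⟩ˡ sheet y) (lookup-retwist R u i) ⟩
        π′ R (map base u) i ⟨$⟩ˡ sheet (point _ _)
          ≡⟨ cong (π′ R (map base u) i ⟨$⟩ˡ_) (sheet-point _ _) ⟩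
        π′ R (map base u) i ⟨$⟩ˡ (π′ R (map base u) i ⟨$⟩ʳ index π R (map base u) u i)
          ≡⟨ inverseˡ (π′ R (map base u) i) ⟩
        index π R (map base u) u i ∎
        where open ≡-Reasoning

      retwist-rel : ∀ R u → T (coverRel π R u) → T (coverRel π′ R (retwist R u))
      retwist-rel R u p = let q , c = coverRel⁻ π R u p in
        coverRel⁺ π′ R (map base u) (retwist R u) (map-base-retwist R u) q
          (λ i j → trans (index-retwist R u i) (trans (c i j) (sym (index-retwist R u j))))

      retwistNode : Node (cover π) → Node (cover π′)
      retwistNode (inj₁ y)           = inj₁ y
      retwistNode (inj₂ (R , u , p)) = inj₂ (R , retwist R u , retwist-rel R u p)

      project-retwist : ∀ v → project π′ (retwistNode v) ≡ project π v
      project-retwist (inj₁ y)           = refl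
      project-retwist (inj₂ (R , u , p)) = cong inj₂ (constraint-≡ X (map-base-retwist R u))

    retwist-inverse : ∀ π π′ v → retwistNode π′ π (retwistNode π π′ v) ≡ v
    retwist-inverse π π′ (inj₁ y)           = refl
    retwist-inverse π π′ (inj₂ (R , u , p)) = cong inj₂ (constraint-≡ (cover π) (vec-ext λ i → begin
      lookup (retwist π′ π R u′) i
        ≡⟨ lookup-retwist π′ π R u′ i ⟩
      point (base (lookup u′ i)) (π R (map base u′) i ⟨$⟩ʳ index π′ R (map base u′) u′ i)
        ≡⟨ cong₂ (λ x t → point x (π R t i ⟨$⟩ʳ index π′ R t u′ i))
             (trans (sym (Vec.lookup-map i base u′))
               (trans (cong (λ t → lookup t i) (map-base-retwist π π′ R u)) (Vec.lookup-map i base u)))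
             (map-base-retwist π π′ R u) ⟩
      point (base (lookup u i)) (π R (map base u) i ⟨$⟩ʳ index π′ R (map base u) u′ i)
        ≡⟨ cong (λ s → point _ (π R (map base u) i ⟨$⟩ʳ s)) (index-retwist π π′ R u i) ⟩
      point (base (lookup u i)) (π R (map base u) i ⟨$⟩ʳ index π R (map base u) u i)
        ≡⟨ cong (point _) (inverseʳ (π R (map base u) i)) ⟩
      point (base (lookup u i)) (sheet (lookup u i))
        ≡⟨ point-base-sheet _ ⟩
      lookup u i ∎))
      where
      open ≡-Reasoning
      u′ = retwist π π′ R u

    -- Points stay fixed and constraints are matched by base and index. Matched nodes have the same
    -- projection, and their iterated degrees are compared through `X`.
    covers-≡₁ : ∀ π π′ → cover π ≡₁ cover π′
    covers-≡₁ π π′ =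
      mk↔ₛ′ (retwistNode π π′) (retwistNode π′ π) (retwist-inverse π′ π) (retwist-inverse π π′) ,
      λ v j → sameDeg-trans j (sameDeg-project π j v)
        (subst (λ w → SameDeg X (cover π′) j w (retwistNode π π′ v)) (project-retwist π π′ v)
          (sameDeg-sym j (sameDeg-project π′ j (retwistNode π π′ v))))

-- Rationals with a common denominator

infix 8 _/suc_

opaque
  _/suc_ : ℕ → ℕ → ℚ
  n /suc d = ℚ.fromℚᵘ (mkℚᵘ (pos n) d)

  toℚᵘ-/suc : ∀ n d → ℚ.toℚᵘ (n /suc d) ℚᵘ.≃ mkℚᵘ (pos n) d
  toℚᵘ-/suc n d = ℚ.toℚᵘ-fromℚᵘ (mkℚᵘ (pos n) d)

/suc-unique : ∀ p n d → ℚ.toℚᵘ p ℚᵘ.≃ mkℚᵘ (pos n) d → p ≡ n /suc d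
/suc-unique p n d eq = ℚ.toℚᵘ-injective (ℚᵘ.≃-trans eq (ℚᵘ.≃-sym (toℚᵘ-/suc n d)))

cross-multiply : ∀ {m n d e} → m * suc e ≡ n * suc d → mkℚᵘ (pos m) d ℚᵘ.≃ mkℚᵘ (pos n) e
cross-multiply {m} {n} {d} {e} eq =
  *≡* (trans (sym (ℤ.pos-* m (suc e))) (trans (cong pos eq) (ℤ.pos-* n (suc d))))

/suc-cong : ∀ {m n d e} → m * suc e ≡ n * suc d → m /suc d ≡ n /suc e
/suc-cong {m} {n} {d} {e} eq = /suc-unique (m /suc d) n e
  (ℚᵘ.≃-trans (toℚᵘ-/suc m d) (cross-multiply {m} {n} eq))

/suc-injective : ∀ {m n d} → m /suc d ≡ n /suc d → m ≡ n
/suc-injective {m} {n} {d} eq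
  with ℚᵘ.≃-trans (ℚᵘ.≃-sym (toℚᵘ-/suc m d)) (ℚᵘ.≃-trans (ℚ.toℚᵘ-cong eq) (toℚᵘ-/suc n d))
... | *≡* eq′ = ℤ.+-injective (ℤ.*-cancelʳ-≡ (pos m) (pos n) (pos (suc d)) eq′)

0/suc : ∀ d → 0 /suc d ≡ 0ℚ
0/suc d = sym (/suc-unique 0ℚ 0 d (cross-multiply {0} {0} {0} {d} refl))

suc/suc : ∀ d → suc d /suc d ≡ 1ℚ
suc/suc d = sym (/suc-unique 1ℚ (suc d) d
  (cross-multiply {1} {suc d} {0} {d} (trans (ℕ.*-identityˡ _) (sym (ℕ.*-identityʳ _)))))

/suc-+ : ∀ m n d → m /suc d ℚ.+ n /suc d ≡ (m + n) /suc d
/suc-+ m n d = /suc-unique _ (m + n) d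
  (ℚᵘ.≃-trans (ℚ.toℚᵘ-homo-+ (m /suc d) (n /suc d))
  (ℚᵘ.≃-trans (ℚᵘ.+-cong (toℚᵘ-/suc m d) (toℚᵘ-/suc n d))
  (*≡* (trans (cong (ℤ._* pos (suc d)) (sym (ℤ.*-distribʳ-+ (pos (suc d)) (pos m) (pos n))))
              (ℤ.*-assoc (pos (m + n)) (pos (suc d)) (pos (suc d)))))))

/suc-mono : ∀ {m n} d → m ≤ n → m /suc d ℚ.≤ n /suc d
/suc-mono {m} {n} d m≤n = ℚ.toℚᵘ-cancel-≤
  (ℚᵘ.≤-respˡ-≃ (ℚᵘ.≃-sym (toℚᵘ-/suc m d)) (ℚᵘ.≤-respʳ-≃ (ℚᵘ.≃-sym (toℚᵘ-/suc n d))
    (*≤* (ℤ.*-monoʳ-≤-nonNeg (pos (suc d)) (ℤ.+≤+ m≤n)))))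

/suc-range : ∀ {n} d → n ≤ suc d → (0ℚ ℚ.≤ n /suc d) × (n /suc d ℚ.≤ 1ℚ)
/suc-range {n} d n≤ = subst (ℚ._≤ n /suc d) (0/suc d) (/suc-mono d z≤n) ,
                      subst (n /suc d ℚ.≤_) (suc/suc d) (/suc-mono d n≤)

/suc-surjective : ∀ p d → 0ℚ ℚ.≤ p → ℚ.denominatorℕ p ∣ suc d → ∃ λ n → p ≡ n /suc d
/suc-surjective p@(mkℚ (pos n) e _) d 0≤p (divides q eq) = n * q , /suc-unique p (n * q) d
  (cross-multiply {n} {n * q} (trans (cong (n *_) eq) (sym (ℕ.*-assoc n q (suc e)))))
/suc-surjective (mkℚ -[1+ n ] e _) d (*≤* ()) _

opaque
  unfolding ⟦_⟧

  if-/suc : ∀ {P : Set} (p? : Dec P) n d →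
            (if ⌊ p? ⌋ then n /suc d else 0ℚ) ≡ (n * ⟦ p? ⟧) /suc d
  if-/suc (yes _) n d = cong (_/suc d) (sym (ℕ.*-identityʳ n))
  if-/suc (no _)  n d = trans (sym (0/suc d)) (cong (_/suc d) (sym (ℕ.*-zeroʳ n)))

common-multiple : (F : Finite S) (m : S → ℕ) → ∃ λ d → ∀ x → suc (m x) ∣ suc d
common-multiple F m = let d , ∣d = go (m ∘ to (enum F)) in
  d , λ x → subst (λ y → suc (m y) ∣ suc d) (strictlyInverseˡ (enum F) x) (∣d (from (enum F) x))
  where
  go : ∀ {n} (m : Fin n → ℕ) → ∃ λ d → ∀ i → suc (m i) ∣ suc d
  go {zero}  m = 0 , λ ()
  go {suc n} m = let d , ∣d = go (m ∘ suc) in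
    -- The successor of this number is `suc (m zero) * suc d`, so `suc d` ends up as the product of
    -- all the `suc (m i)`.
    d + m zero * suc d , λ where
      zero    → m∣m*n (suc d)
      (suc i) → ∣n⇒∣m*n (suc (m zero)) (∣d i)

-- Sums in the linear programs, and symmetric operations on multisets

module _ {σ : Signature} where

  sumFin-/suc : ∀ d m (f : Fin m → ℕ) → sumFin {σ} m (λ a → f a /suc d) ≡ ∑ fin f /suc d
  sumFin-/suc d m f = go m (λ i → i)
    where
    -- The tail of `allFin` is tabulated from `suc`, so the induction runs over an arbitrary
    -- tabulated `g`.
    go : ∀ k (g : Fin k → Fin m) →
         List.foldr ℚ._+_ 0ℚ (List.map (λ a → f a /suc d) (List.tabulate g)) ≡ ∑ fin (f ∘ g) /suc d
    go zero    g = trans (sym (0/suc d)) (cong (_/suc d) (sym (∑-Fin-zero (f ∘ g))))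
    go (suc k) g = begin
      f (g zero) /suc d ℚ.+ _                          ≡⟨ cong (f (g zero) /suc d ℚ.+_) (go k (g ∘ suc)) ⟩
      f (g zero) /suc d ℚ.+ ∑ fin (f ∘ g ∘ suc) /suc d ≡⟨ /suc-+ _ _ d ⟩
      (f (g zero) + ∑ fin (f ∘ g ∘ suc)) /suc d        ≡⟨ cong (_/suc d) (∑-Fin-suc (f ∘ g)) ⟨
      ∑ fin (f ∘ g) /suc d                             ∎
      where open ≡-Reasoning

  sumFin-cong : ∀ m {f g : Fin m → ℚ} → (∀ a → f a ≡ g a) → sumFin {σ} m f ≡ sumFin {σ} m g
  sumFin-cong m eq = cong (List.foldr ℚ._+_ 0ℚ) (List.map-cong eq (List.allFin m))

  sumTuples-/suc : ∀ d m k (g : Vec (Fin m) k → ℚ) (f : Vec (Fin m) k → ℕ) →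
                   (∀ t → g t ≡ f t /suc d) → sumTuples {σ} m k g ≡ ∑ (finiteVec fin k) f /suc d
  sumTuples-/suc d m zero    g f eq = trans (eq []) (cong (_/suc d) (sym (∑-Vec-[] fin f)))
  sumTuples-/suc d m (suc k) g f eq = begin
    sumFin {σ} m (λ a → sumTuples {σ} m k (λ t → g (a ∷ t)))
      ≡⟨ sumFin-cong m (λ a → sumTuples-/suc d m k _ _ (λ t → eq (a ∷ t))) ⟩
    sumFin {σ} m (λ a → ∑ (finiteVec fin k) (λ t → f (a ∷ t)) /suc d)
      ≡⟨ sumFin-/suc d m _ ⟩
    ∑ fin (λ a → ∑ (finiteVec fin k) (λ t → f (a ∷ t))) /suc d
      ≡⟨ cong (_/suc d) (∑-Vec-∷ fin k f) ⟨
    ∑ (finiteVec fin (suc k)) f /suc d ∎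
    where open ≡-Reasoning

  finiteConstraint : (X : Structure σ) → Finite (Constraint X)
  finiteConstraint X = finiteΣ fin λ R → finiteΣ (finiteVec fin (ar σ R)) λ t →
                       finiteDec (T? (rel X R t)) T-irrelevant

  -- Equal multiplicities provide a permutation carrying one argument vector to the other, so a
  -- symmetric operation is a function of multisets.
  symmetric-multiplicity : ∀ {m k} {f : Vec (Fin m) k → Fin m} → IsSymmetric {σ} k f → ∀ u v →
    (∀ a → multiplicity _≟_ fin (lookup u) a ≡ multiplicity _≟_ fin (lookup v) a) → f u ≡ f v
  symmetric-multiplicity {f = f} sym-f u v eq =
    let ρ , v∘ρ≡u = multiplicity≗⇒↔ _≟_ fin fin (lookup u) (lookup v) eq in
    sym (trans (sym-f v ρ) (cong f (trans (Vec.tabulate-cong v∘ρ≡u) (Vec.tabulate∘lookup u))))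

-- From symmetric polymorphisms to the basic linear program

module Symmetric⇒BLP {σ : Signature} (A : Structure σ) (poly : HasAllSymmetricPolymorphisms A)
  (X : Structure σ) (sol : BLPSolution X A) where

  open BLPSolution sol

  n : ℕ
  n = size A

  Tuples : ∀ R → Finite (Vec (Fin n) (ar σ R))
  Tuples R = finiteVec fin (ar σ R)

  Unknown : Set
  Unknown = (Fin (size X) × Fin n) ⊎ Σ (Constraint X) (λ c → Vec (Fin n) (ar σ (proj₁ c)))

  value : Unknown → ℚ
  value (inj₁ (x , a)) = pv x a
  value (inj₂ (c , b)) = pc c b

  value-nonneg : ∀ s → 0ℚ ℚ.≤ value s
  value-nonneg (inj₁ (x , a)) = proj₁ (pv-range x a)
  value-nonneg (inj₂ (c , b)) = proj₁ (pc-range c b)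

  common-denominator : ∃ λ d → ∀ s → ℚ.denominatorℕ (value s) ∣ suc d
  common-denominator = common-multiple
    (finite⊎ (finite× fin fin) (finiteΣ (finiteConstraint X) (Tuples ∘ proj₁)))
    (ℚ.denominator-1 ∘ value)

  d : ℕ
  d = proj₁ common-denominator

  numerator : ∀ s → ∃ λ m → value s ≡ m /suc d
  numerator s = /suc-surjective (value s) d (value-nonneg s) (proj₂ common-denominator s)

  mv : Fin (size X) → Fin n → ℕ
  mv x a = proj₁ (numerator (inj₁ (x , a)))

  mc : (c : Constraint X) → Vec (Fin n) (ar σ (proj₁ c)) → ℕ
  mc c b = proj₁ (numerator (inj₂ (c , b)))

  ∑-mv : ∀ x → ∑ fin (mv x) ≡ suc d
  ∑-mv x = /suc-injective (begin
    ∑ fin (mv x) /suc d                 ≡⟨ sumFin-/suc {σ} d n (mv x) ⟨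
    sumFin {σ} n (λ a → mv x a /suc d)  ≡⟨ sumFin-cong {σ} n (λ a → proj₂ (numerator (inj₁ (x , a)))) ⟨
    sumFin {σ} n (pv x)                 ≡⟨ pv-sum x ⟩
    1ℚ                                  ≡⟨ suc/suc d ⟨
    suc d /suc d                        ∎)
    where open ≡-Reasoning

  marginal-mc : ∀ R t p i a → mv (lookup t i) a ≡
                ∑ (Tuples R) (λ b → mc (R , t , p) b * ⟦ lookup b i ≟ a ⟧)
  marginal-mc R t p i a = /suc-injective (begin
    mv (lookup t i) a /suc d
      ≡⟨ proj₂ (numerator (inj₁ (lookup t i , a))) ⟨
    pv (lookup t i) a
      ≡⟨ marginal (R , t , p) a i ⟩
    sumTuples {σ} n (ar σ R) (λ b → if ⌊ lookup b i ≟ a ⌋ then pc (R , t , p) b else 0ℚ)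
      ≡⟨ sumTuples-/suc {σ} d n (ar σ R) _ _ (λ b → trans
           (cong (λ q → if ⌊ lookup b i ≟ a ⌋ then q else 0ℚ) (proj₂ (numerator (inj₂ ((R , t , p) , b)))))
           (if-/suc (lookup b i ≟ a) _ d)) ⟩
    ∑ (Tuples R) (λ b → mc (R , t , p) b * ⟦ lookup b i ≟ a ⟧) /suc d ∎)
    where open ≡-Reasoning

  -- The program does not state the total weight of a constraint. It follows by adding up the
  -- marginals at one position `i`, which must therefore exist.
  ∑-mc : ∀ R t p → Fin (ar σ R) → ∑ (Tuples R) (mc (R , t , p)) ≡ suc d
  ∑-mc R t p i = begin
    ∑ (Tuples R) (mc (R , t , p))
      ≡⟨ ∑-cong (Tuples R) (λ b → ∑-⟦≡⟧ (mc (R , t , p) b) (lookup b i)) ⟨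
    ∑ (Tuples R) (λ b → ∑ fin (λ a → mc (R , t , p) b * ⟦ lookup b i ≟ a ⟧))
      ≡⟨ ∑-swap (Tuples R) fin _ ⟩
    ∑ fin (λ a → ∑ (Tuples R) (λ b → mc (R , t , p) b * ⟦ lookup b i ≟ a ⟧))
      ≡⟨ ∑-cong fin (marginal-mc R t p i) ⟨
    ∑ fin (mv (lookup t i))
      ≡⟨ ∑-mv (lookup t i) ⟩
    suc d ∎
    where
    open ≡-Reasoning
    ∑-⟦≡⟧ : ∀ m b → ∑ fin (λ a → m * ⟦ b ≟ a ⟧) ≡ m
    ∑-⟦≡⟧ m b = trans
      (∑-single fin _ b (λ a a≢b → trans (cong (m *_) (⟦⟧-no (b ≟ a) (a≢b ∘ sym))) (ℕ.*-zeroʳ m)))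
      (trans (cong (m *_) (⟦⟧-yes (b ≟ b) refl)) (ℕ.*-identityʳ m))

  f : Vec (Fin n) (suc d) → Fin n
  f = proj₁ (poly d)

  family : ∀ x → Σ (Fin (suc d) → Fin n) λ g →
           (∀ w → ∑ fin (w ∘ g) ≡ ∑ fin (λ a → mv x a * w a)) × (∀ j → mv x (g j) ≢ 0)
  family x = realise fin (mv x) (∑-mv x)

  vector : Fin (size X) → Vec (Fin n) (suc d)
  vector x = tabulate (proj₁ (family x))

  multiplicity-vector : ∀ x a → multiplicity _≟_ fin (lookup (vector x)) a ≡ mv x a
  multiplicity-vector x a = begin
    multiplicity _≟_ fin (lookup (vector x)) a
      ≡⟨ ∑-cong fin (λ j → cong (λ b → ⟦ b ≟ a ⟧) (Vec.lookup∘tabulate (proj₁ (family x)) j)) ⟩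
    ∑ fin (λ j → ⟦ proj₁ (family x) j ≟ a ⟧)
      ≡⟨ proj₁ (proj₂ (family x)) (λ b → ⟦ b ≟ a ⟧) ⟩
    ∑ fin (λ b → mv x b * ⟦ b ≟ a ⟧)
      ≡⟨ ∑-count-≡ fin _≟_ (mv x) a ⟩
    mv x a ∎
    where open ≡-Reasoning

  h : Fin (size X) → Fin n
  h = f ∘ vector

  -- Take the tuples realising the weights of the constraint as rows. Column `i` is a rearrangement
  -- of `vector (lookup t i)`, so `f` applied to the columns yields the values of `h` along `t`.
  h-preserves : ∀ R t → T (rel X R t) → Fin (ar σ R) → T (rel A R (map h t))
  h-preserves R t p i₀ = subst (T ∘ rel A R)
    (vec-ext λ i → trans (Vec.lookup∘tabulate _ i)
      (trans (symmetric-multiplicity {σ} (proj₂ (proj₂ (poly d))) _ _ (λ a → same i a))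
        (sym (Vec.lookup-map i h t))))
    (proj₁ (proj₂ (poly d)) R rows (λ j → subst (T ∘ rel A R) (sym (Vec.lookup∘tabulate g j)) (g∈A j)))
    where
    open ≡-Reasoning
    c : Constraint X
    c = R , t , p
    realisation = realise (Tuples R) (mc c) (∑-mc R t p i₀)
    g = proj₁ realisation
    rows = tabulate g
    -- Only tuples of nonzero weight are listed, and `support` gives weight zero outside the
    -- relation.
    g∈A : ∀ j → T (rel A R (g j))
    g∈A j with rel A R (g j) in eq
    ... | true  = _
    ... | false = contradiction
      (/suc-injective (trans (sym (proj₂ (numerator (inj₂ (c , g j)))))
        (trans (support c (g j) eq) (sym (0/suc d)))))
      (proj₂ (proj₂ realisation) j)
    -- Both multiplicities are the numerator of the marginal at position `i`.
    same : ∀ i a → multiplicity _≟_ fin (lookup (map (λ b → lookup b i) rows)) a ≡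
                   multiplicity _≟_ fin (lookup (vector (lookup t i))) a
    same i a = begin
      multiplicity _≟_ fin (lookup (map (λ b → lookup b i) rows)) a
        ≡⟨ ∑-cong fin (λ j → cong (λ b → ⟦ b ≟ a ⟧) (trans (Vec.lookup-map j (λ b → lookup b i) rows)
             (cong (λ b → lookup b i) (Vec.lookup∘tabulate g j)))) ⟩
      ∑ fin (λ j → ⟦ lookup (g j) i ≟ a ⟧)
        ≡⟨ proj₁ (proj₂ realisation) (λ b → ⟦ lookup b i ≟ a ⟧) ⟩
      ∑ (Tuples R) (λ b → mc c b * ⟦ lookup b i ≟ a ⟧)
        ≡⟨ marginal-mc R t p i a ⟨
      mv (lookup t i) a
        ≡⟨ multiplicity-vector (lookup t i) a ⟨
      multiplicity _≟_ fin (lookup (vector (lookup t i))) a ∎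

  -- For a nullary R the solution carries no information, but R is non-empty in A.
  homomorphism : X ⟶ A
  homomorphism = h , λ R t p → case Fin.any? (λ (i : Fin (ar σ R)) → yes tt) of λ where
    (yes (i , _)) → h-preserves R t p i
    (no none)     → subst (T ∘ rel A R) (vec-ext λ i → contradiction (i , tt) none) (proj₂ (nonempty A R))

-- Colour refinement, with colourings represented by their kernels

module Refinement {V L : Set} (finiteV : Finite V) (_≟ᴸ_ : DecidableEquality L)
  (E : V → Set) (finiteE : ∀ v → Finite (E v))
  (edgeLabel : ∀ v → E v → L) (target : ∀ v → E v → V) where

  Edge : Set
  Edge = Σ V E

  -- An edge `(u , ε)` stands for its label together with the class of its target. For reflexive
  -- `r`, every such pair that occurs at a node is named by some edge.
  match? : ∀ (r : V → V → Bool) v e ((u , ε) : Edge) → Dec (edgeLabel v e ≡ edgeLabel u ε × T (r (target v e) (target u ε)))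
  match? r v e (u , ε) = (edgeLabel v e ≟ᴸ edgeLabel u ε) ×-dec T? (r (target v e) (target u ε))

  degree : (V → V → Bool) → (v : V) → Edge → ℕ
  degree r v ε = count (finiteE v) (λ e → match? r v e ε)

  degrees? : ∀ r v w → Dec (∀ ε → degree r v ε ≡ degree r w ε)
  degrees? r v w = all? (finiteΣ finiteV finiteE) λ ε → degree r v ε ℕ.≟ degree r w ε

  -- Keeping the conjunct `r v w` makes the sequence of kernels decreasing.
  refine : (V → V → Bool) → V → V → Bool
  refine r v w = ⌊ T? (r v w) ×-dec degrees? r v w ⌋

  refine⁺ : ∀ r {v w} → T (r v w) → (∀ ε → degree r v ε ≡ degree r w ε) → T (refine r v w)
  refine⁺ r vw eq = fromWitness (vw , eq)

  refine⁻ : ∀ r {v w} → T (refine r v w) → T (r v w) × (∀ ε → degree r v ε ≡ degree r w ε)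
  refine⁻ r = toWitness

  -- The initial colouring has a single class. In a factor graph a class may thus contain both
  -- elements and constraints, and the counts over classes below range over one kind at a time.
  kernel : ℕ → V → V → Bool
  kernel zero    _ _ = true
  kernel (suc j)     = refine (kernel j)

  kernel-refl : ∀ j {v} → T (kernel j v v)
  kernel-refl zero    = _
  kernel-refl (suc j) = refine⁺ (kernel j) (kernel-refl j) (λ _ → refl)

  kernel-sym : ∀ j {v w} → T (kernel j v w) → T (kernel j w v)
  kernel-sym zero    _  = _
  kernel-sym (suc j) vw = let p , eq = refine⁻ (kernel j) vw in
    refine⁺ (kernel j) (kernel-sym j p) (sym ∘ eq)

  kernel-trans : ∀ j {u v w} → T (kernel j u v) → T (kernel j v w) → T (kernel j u w)
  kernel-trans zero    _ _ = _
  kernel-trans (suc j) uv vw =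
    let p , eq = refine⁻ (kernel j) uv ; p′ , eq′ = refine⁻ (kernel j) vw in
    refine⁺ (kernel j) (kernel-trans j p p′) (λ ε → trans (eq ε) (eq′ ε))

  Equitable : (V → V → Bool) → Set
  Equitable r = ∀ {v w} → T (r v w) → ∀ ε → degree r v ε ≡ degree r w ε

  weight : (V → V → Bool) → ℕ
  weight r = count (finite× finiteV finiteV) (λ (v , w) → T? (r v w))

  opaque
    -- Each proper refinement decreases the number of related pairs.
    stabilises : ∃ λ j → Equitable (kernel j)
    stabilises = go 0 (suc (weight (kernel 0))) ℕ.≤-refl
      where
      pairs : Finite (V × V)
      pairs = finite× finiteV finiteV
      go : ∀ j bound → weight (kernel j) < bound → ∃ λ j → Equitable (kernel j)
      go j (suc bound) lt with any? pairs (λ (v , w) → T? (kernel j v w) ×-dec Dec.¬? (T? (kernel (suc j) v w)))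
      ... | yes ((v , w) , vw , ¬vw) = go (suc j) bound (ℕ.<-≤-trans
        (∑-mono-< pairs
          (λ (v , w) → ⟦⟧-mono (T? (kernel (suc j) v w)) (T? (kernel j v w)) (proj₁ ∘ refine⁻ (kernel j)))
          (v , w)
          (subst₂ _<_ (sym (⟦⟧-no (T? (kernel (suc j) v w)) ¬vw)) (sym (⟦⟧-yes (T? (kernel j v w)) vw)) (s≤s z≤n)))
        (ℕ.≤-pred lt))
      ... | no stable = j , λ {v} {w} vw →
        proj₂ (refine⁻ (kernel j) (Dec.decidable-stable (T? (kernel (suc j) v w)) (λ ¬vw → stable ((v , w) , vw , ¬vw))))

-- Incidences and edge labels of finite factor graphs

infix 4 _≟ᴸ_

_≟ᴸ_ : ∀ {n} → DecidableEquality (Fin n × List Bool)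
_≟ᴸ_ = Product.≡-dec _≟_ (List.≡-dec Bool._≟_)

module _ {σ : Signature} where

  finiteNode : (X : Structure σ) → Finite (Node X)
  finiteNode X = finite⊎ fin (finiteConstraint X)

  finiteAdj : (X : Structure σ) (v : Node X) → Finite (Adj X v)
  finiteAdj X (inj₁ x)           = finiteΣ (finiteConstraint X) λ (R , t , p) →
                                   finiteDec (T? (_∈ᵇ_ {σ} x t)) T-irrelevant
  finiteAdj X (inj₂ (R , t , p)) = finiteΣ fin λ x → finiteDec (T? (_∈ᵇ_ {σ} x t)) T-irrelevant

  Incident : (X : Structure σ) → Constraint X → Fin (size X) → Set
  Incident X (R , t , p) x = T (_∈ᵇ_ {σ} x t)

  -- Both sides sum over the edges of the factor graph, each grouping them by one of the two ends.
  incidence-swap : (X : Structure σ) (f : Constraint X → Fin (size X) → ℕ) →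
    ∑ (finiteConstraint X) (λ c → ∑ (finiteAdj X (inj₂ c)) (λ (x , _) → f c x)) ≡
    ∑ fin (λ x → ∑ (finiteAdj X (inj₁ x)) (λ (c , _) → f c x))
  incidence-swap X f = begin
    ∑ (finiteConstraint X) (λ c → ∑ (finiteAdj X (inj₂ c)) (λ (x , _) → f c x))
      ≡⟨ ∑-Σ (finiteConstraint X) (λ c → finiteAdj X (inj₂ c)) (λ (c , x , _) → f c x) ⟨
    ∑ (finiteΣ (finiteConstraint X) (λ c → finiteAdj X (inj₂ c))) (λ (c , x , _) → f c x)
      ≡⟨ ∑-↔ (finiteΣ fin (λ x → finiteAdj X (inj₁ x)))
           (finiteΣ (finiteConstraint X) (λ c → finiteAdj X (inj₂ c))) swap (λ (c , x , _) → f c x) ⟩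
    ∑ (finiteΣ fin (λ x → finiteAdj X (inj₁ x))) (λ (x , c , _) → f c x)
      ≡⟨ ∑-Σ fin (λ x → finiteAdj X (inj₁ x)) (λ (x , c , _) → f c x) ⟩
    ∑ fin (λ x → ∑ (finiteAdj X (inj₁ x)) (λ (c , _) → f c x)) ∎
    where
    open ≡-Reasoning
    swap : Σ (Fin (size X)) (λ x → Adj X (inj₁ x)) ↔ Σ (Constraint X) (λ c → Adj X (inj₂ c))
    swap = mk↔ₛ′ (λ (x , c , m) → c , x , m) (λ (c , x , m) → x , c , m) (λ _ → refl) (λ _ → refl)

  -- The bits of a label mark the positions of its element, so equal labels mark the same positions.
  label-lookup : ∀ {R m n} {s : Vec (Fin m) (ar σ R)} {t : Vec (Fin n) (ar σ R)} {x y} →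
                 label {σ} R s x ≡ label {σ} R t y → ∀ i → lookup t i ≡ y → lookup s i ≡ x
  label-lookup {s = s} {t} {x} {y} eq i ti≡y = toWitness (subst T (sym (begin
    ⌊ lookup s i ≟ x ⌋                  ≡⟨ Vec.lookup-map i _ s ⟨
    lookup (map (λ b → ⌊ b ≟ x ⌋) s) i  ≡⟨ cong (λ bs → lookup bs i) (trans (sym (Vec.cast-is-id refl _))
                                             (Vec.toList-injective refl _ _ (,-injectiveʳ eq))) ⟩
    lookup (map (λ b → ⌊ b ≟ y ⌋) t) i  ≡⟨ Vec.lookup-map i _ t ⟩
    ⌊ lookup t i ≟ y ⌋                  ∎)) (fromWitness ti≡y))
    where
    open ≡-Reasoning
    ,-injectiveʳ : {S U : Set} {a c : S} {b d : U} → (a , b) ≡ (c , d) → b ≡ d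
    ,-injectiveʳ refl = refl

  label-injective : ∀ R {m} (t : Vec (Fin m) (ar σ R)) {x y} → T (_∈ᵇ_ {σ} x t) →
                    label {σ} R t x ≡ label {σ} R t y → x ≡ y
  label-injective R t x∈ eq = let i , ti≡x = ∈⇒lookup {σ} t x∈ in
    trans (sym ti≡x) (label-lookup {s = t} {t} (sym eq) i ti≡x)

  -- Factor graphs are bipartite: the kind of a node determines the kind of its neighbours.
  sameDeg-adj₀ : ∀ {X Y : Structure σ} v w → SameDeg X Y 0 v w → (e : Adj X v) (e′ : Adj Y w) →
                 SameDeg X Y 0 (adjNode X v e) (adjNode Y w e′)
  sameDeg-adj₀ (inj₁ _) (inj₁ _) _ _ _ = refl
  sameDeg-adj₀ (inj₂ _) (inj₂ _) _ _ _ = refl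

  -- SameDeg 1 does not imply SameDeg 0: an isolated element and a nullary constraint both have
  -- no neighbours.
  sameDeg-pred : ∀ {X Y : Structure σ} j {v w} → SameDeg X Y 0 v w →
                 SameDeg X Y (suc j) v w → SameDeg X Y j v w
  sameDeg-pred         zero            same₀ _          = same₀
  sameDeg-pred {X} {Y} (suc j) {v} {w} same₀ (φ , pres) = φ , λ e →
    Product.map₂ (sameDeg-pred j (sameDeg-adj₀ v w same₀ e (to φ e))) (pres e)

-- Averaging a homomorphism over stable colour classes

module ≡₁⇒SA1 {σ : Signature} (A X Y : Structure σ) (X≡Y : X ≡₁ Y) (X⟶A : X ⟶ A) where

  -- Refining the disjoint union of both factor graphs makes the colours in `X` and `Y` comparable.
  Vertex : Set
  Vertex = Node X ⊎ Node Y

  Adjᵛ : Vertex → Set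
  Adjᵛ (inj₁ v) = Adj X v
  Adjᵛ (inj₂ w) = Adj Y w

  finiteAdjᵛ : ∀ v → Finite (Adjᵛ v)
  finiteAdjᵛ (inj₁ v) = finiteAdj X v
  finiteAdjᵛ (inj₂ w) = finiteAdj Y w

  adjLabelᵛ : ∀ v → Adjᵛ v → Label {σ}
  adjLabelᵛ (inj₁ v) = adjLabel X v
  adjLabelᵛ (inj₂ w) = adjLabel Y w

  adjNodeᵛ : ∀ v → Adjᵛ v → Vertex
  adjNodeᵛ (inj₁ v) e = inj₁ (adjNode X v e)
  adjNodeᵛ (inj₂ w) e = inj₂ (adjNode Y w e)

  open Refinement (finite⊎ (finiteNode X) (finiteNode Y)) _≟ᴸ_ Adjᵛ finiteAdjᵛ adjLabelᵛ adjNodeᵛ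

  -- The bijection of neighbourhoods preserves labels and, by induction, classes of targets. Hence
  -- it preserves all degrees, and round `j` cannot separate the two nodes.
  sameDeg⇒kernel : ∀ j v w → SameDeg X Y 0 v w → SameDeg X Y j v w → T (kernel j (inj₁ v) (inj₂ w))
  sameDeg⇒kernel zero    v w same₀ _ = _
  sameDeg⇒kernel (suc j) v w same₀ (φ , pres) = refine⁺ (kernel j)
    (sameDeg⇒kernel j v w same₀ (sameDeg-pred j same₀ (φ , pres)))
    (λ (u , ε) → sym (trans (∑-↔ (finiteAdj X v) (finiteAdj Y w) φ _) (∑-cong (finiteAdj X v) λ e →
      let eq , same = pres e
          related   = sameDeg⇒kernel j _ _ (sameDeg-adj₀ v w same₀ e (to φ e)) same
      in sym (⟦⟧-cong (match? (kernel j) (inj₁ v) e (u , ε)) (match? (kernel j) (inj₂ w) (to φ e) (u , ε))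
           (λ (l , k) → trans (sym eq) l , kernel-trans j (kernel-sym j related) k)
           (λ (l , k) → trans eq l , kernel-trans j related k)))))

  _~_ : Vertex → Vertex → Set
  v ~ w = T (kernel (proj₁ stabilises) v w)

  _~?_ : ∀ v w → Dec (v ~ w)
  v ~? w = T? _

  deg : Vertex → Edge → ℕ
  deg = degree (kernel (proj₁ stabilises))

  equitable : ∀ {v w} → v ~ w → ∀ ε → deg v ε ≡ deg w ε
  equitable = proj₂ stabilises

  ~-refl : ∀ {v} → v ~ v
  ~-refl = kernel-refl (proj₁ stabilises)

  varˣ : Fin (size X) → Vertex
  varˣ y = inj₁ (inj₁ y)

  conˣ : Constraint X → Vertex
  conˣ c = inj₁ (inj₂ c)

  varʸ : Fin (size Y) → Vertex
  varʸ x = inj₂ (inj₁ x)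

  conʸ : Constraint Y → Vertex
  conʸ c = inj₂ (inj₂ c)

  -- Every class that meets `Y` meets `X` in a node of the same kind, so no average below divides by
  -- zero.
  preimage : ∀ w → ∃ λ v → SameDeg X Y 0 v w × inj₁ v ~ inj₂ w
  preimage w = let φ , same = X≡Y ; v = from φ w in v ,
    subst (λ w′ → SameDeg X Y 0 v w′ × inj₁ v ~ inj₂ w′) (strictlyInverseˡ φ w)
      (same v 0 , sameDeg⇒kernel (proj₁ stabilises) v (to φ v) (same v 0) (same v (proj₁ stabilises)))

  classVar : Fin (size Y) → ℕ
  classVar x = count fin (λ y → varˣ y ~? varʸ x)

  classCon : Constraint Y → ℕ
  classCon c = count (finiteConstraint X) (λ c′ → conˣ c′ ~? conʸ c)

  classVar-pos : ∀ x → 1 ≤ classVar x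
  classVar-pos x with preimage (inj₁ x)
  ... | inj₁ y , _ , y~x = count-pos fin (λ y → varˣ y ~? varʸ x) y y~x

  classCon-pos : ∀ c → 1 ≤ classCon c
  classCon-pos c with preimage (inj₂ c)
  ... | inj₂ c′ , _ , c′~c = count-pos (finiteConstraint X) (λ c′ → conˣ c′ ~? conʸ c) c′ c′~c

  g : Fin (size X) → Fin (size A)
  g = proj₁ X⟶A

  Tuple : Set
  Tuple = Σ (Fin (nsym σ)) λ R → Vec (Fin (size A)) (ar σ R)

  _≟ᵀ_ : DecidableEquality Tuple
  _≟ᵀ_ = Product.≡-dec _≟_ (Vec.≡-dec _≟_)

  image : Constraint X → Tuple
  image (R , t , _) = R , map g t

  varCount : Fin (size Y) → Fin (size A) → ℕ
  varCount x a = count fin (λ y → (varˣ y ~? varʸ x) ×-dec (g y ≟ a))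

  conCount : Constraint Y → Tuple → ℕ
  conCount c b = count (finiteConstraint X) (λ c′ → (conˣ c′ ~? conʸ c) ×-dec (image c′ ≟ᵀ b))

  edgeIn : (c : Constraint Y) → Fin (ar σ (proj₁ c)) → Edge
  edgeIn c@(R , t , p) i = varʸ (lookup t i) , c , lookup∈ {σ} t i

  edgeOut : (c : Constraint Y) → Fin (ar σ (proj₁ c)) → Edge
  edgeOut c@(R , t , p) i = conʸ c , lookup t i , lookup∈ {σ} t i

  labelAt : (c : Constraint Y) → Fin (ar σ (proj₁ c)) → Label {σ}
  labelAt (R , t , p) i = label {σ} R t (lookup t i)

  labelˣ : Constraint X → Fin (size X) → Label {σ}
  labelˣ (R , t , p) y = label {σ} R t y

  -- `c` has an edge with the label and target class of its `i`-th entry. By equitability `c′` has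
  -- equally many such edges, hence at least one.
  entry : ∀ c c′ → conˣ c′ ~ conʸ c → (i : Fin (ar σ (proj₁ c))) →
          ∃ λ y → Incident X c′ y × labelˣ c′ y ≡ labelAt c i × varˣ y ~ varʸ (lookup (proj₁ (proj₂ c)) i)
  entry c@(R , t , p) c′@(R′ , t′ , p′) c′~c i =
    let ε = edgeOut c i
        (y , y∈) , eq , y~x = count-witness (finiteAdj X (inj₂ c′))
          (λ e → (adjLabel X (inj₂ c′) e ≟ᴸ labelAt c i) ×-dec (inj₁ (adjNode X (inj₂ c′) e) ~? varʸ (lookup t i)))
          (ℕ.≤-trans
            (count-pos (finiteAdj Y (inj₂ c))
              (λ e → (adjLabel Y (inj₂ c) e ≟ᴸ labelAt c i) ×-dec (inj₂ (adjNode Y (inj₂ c) e) ~? varʸ (lookup t i)))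
              (proj₂ ε) (refl , ~-refl))
            (ℕ.≤-reflexive (sym (equitable c′~c ε))))
    in y , y∈ , eq , y~x

  -- Double counting of the incidences between the classes of c and of its i-th entry.
  module _ (c : Constraint Y) (i : Fin (ar σ (proj₁ c))) where

    x : Fin (size Y)
    x = lookup (proj₁ (proj₂ c)) i

    -- By equitability, every element in the class of `x` lies in exactly `D` constraints of the
    -- class of `c` along edges labelled as at `i`.
    D : ℕ
    D = deg (varʸ x) (edgeIn c i)

    entrySum : (Fin (size X) → ℕ) → Constraint X → ℕ
    entrySum w c′ = ∑ (finiteAdj X (inj₂ c′)) (λ (y , _) → ⟦ labelˣ c′ y ≟ᴸ labelAt c i ⟧ * w y)

    -- Within one constraint, a label belongs to at most one of its elements, so a single term
    -- survives.
    entrySum-unique : ∀ w c′ y → Incident X c′ y → labelˣ c′ y ≡ labelAt c i → entrySum w c′ ≡ w y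
    entrySum-unique w c′@(R′ , t′ , p′) y y∈ eq = trans
      (∑-single (finiteAdj X (inj₂ c′)) _ (y , y∈) (λ (z , z∈) z≢y →
        cong (_* w z) (⟦⟧-no (labelˣ c′ z ≟ᴸ labelAt c i)
          (λ eq′ → z≢y (Σ-≡ T-irrelevant (label-injective {σ} R′ t′ z∈ (trans eq′ (sym eq))))))))
      (trans (cong (_* w y) (⟦⟧-yes (labelˣ c′ y ≟ᴸ labelAt c i) eq)) (ℕ.*-identityˡ (w y)))

    -- Suppose `y` has an edge like `edgeIn c i`. By `entry`, the constraint at its other end has an
    -- element with that label in the class of `x`; labels being unique within a constraint, this
    -- element is `y`.
    deg-class : ∀ y → deg (varˣ y) (edgeIn c i) ≡ ⟦ varˣ y ~? varʸ x ⟧ * D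
    deg-class y = go (varˣ y ~? varʸ x)
      where
      go : (d : Dec (varˣ y ~ varʸ x)) → deg (varˣ y) (edgeIn c i) ≡ ⟦ d ⟧ * D
      go (yes y~x) = trans (equitable y~x (edgeIn c i)) (sym (trans (cong (_* D) (⟦⟧-yes (yes y~x) y~x)) (ℕ.*-identityˡ D)))
      go (no y≁x)  = trans
        (∑-zero (finiteAdj X (inj₁ y)) λ (c′ , y∈) →
          ⟦⟧-no (match? (kernel (proj₁ stabilises)) (varˣ y) (c′ , y∈) (edgeIn c i)) λ (eq , c′~c) →
            let z , z∈ , eq′ , z~x = entry c c′ c′~c i
            in y≁x (subst (λ z → varˣ z ~ varʸ x)
                     (label-injective {σ} (proj₁ c′) (proj₁ (proj₂ c′)) z∈ (trans eq′ (sym eq))) z~x))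
        (sym (cong (_* D) (⟦⟧-no (no y≁x) y≁x)))

    -- The weight is constantly 1 for comparing class sizes, and the indicator of `g y ≡ a` for the
    -- marginals.
    double-count : ∀ w → ∑ (finiteConstraint X) (λ c′ → ⟦ conˣ c′ ~? conʸ c ⟧ * entrySum w c′) ≡
                         D * ∑ fin (λ y → ⟦ varˣ y ~? varʸ x ⟧ * w y)
    double-count w = begin
      ∑ (finiteConstraint X) (λ c′ → ⟦ conˣ c′ ~? conʸ c ⟧ * entrySum w c′)
        ≡⟨ ∑-cong (finiteConstraint X) (λ c′ → ∑-*ˡ (finiteAdj X (inj₂ c′)) ⟦ conˣ c′ ~? conʸ c ⟧
             (λ (y , _) → ⟦ labelˣ c′ y ≟ᴸ labelAt c i ⟧ * w y)) ⟨
      ∑ (finiteConstraint X) (λ c′ → ∑ (finiteAdj X (inj₂ c′)) (λ (y , _) → term c′ y))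
        ≡⟨ incidence-swap X term ⟩
      ∑ fin (λ y → ∑ (finiteAdj X (inj₁ y)) (λ (c′ , _) → term c′ y))
        ≡⟨ ∑-cong fin (λ y → trans
             (∑-cong (finiteAdj X (inj₁ y)) (λ (c′ , _) → term-≡ c′ y))
             (∑-*ʳ (finiteAdj X (inj₁ y)) (w y) (λ e → ⟦ match? (kernel (proj₁ stabilises)) (varˣ y) e (edgeIn c i) ⟧))) ⟩
      ∑ fin (λ y → deg (varˣ y) (edgeIn c i) * w y)
        ≡⟨ ∑-cong fin (λ y → trans (cong (_* w y) (trans (deg-class y) (ℕ.*-comm ⟦ varˣ y ~? varʸ x ⟧ D)))
             (ℕ.*-assoc D ⟦ varˣ y ~? varʸ x ⟧ (w y))) ⟩
      ∑ fin (λ y → D * (⟦ varˣ y ~? varʸ x ⟧ * w y))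
        ≡⟨ ∑-*ˡ fin D (λ y → ⟦ varˣ y ~? varʸ x ⟧ * w y) ⟩
      D * ∑ fin (λ y → ⟦ varˣ y ~? varʸ x ⟧ * w y) ∎
      where
      open ≡-Reasoning
      term : Constraint X → Fin (size X) → ℕ
      term c′ y = ⟦ conˣ c′ ~? conʸ c ⟧ * (⟦ labelˣ c′ y ≟ᴸ labelAt c i ⟧ * w y)
      term-≡ : ∀ c′ y → term c′ y ≡ ⟦ (labelˣ c′ y ≟ᴸ labelAt c i) ×-dec (conˣ c′ ~? conʸ c) ⟧ * w y
      term-≡ c′ y = begin
        ⟦ q ⟧ * (⟦ l ⟧ * w y)  ≡⟨ ℕ.*-assoc ⟦ q ⟧ ⟦ l ⟧ (w y) ⟨
        ⟦ q ⟧ * ⟦ l ⟧ * w y    ≡⟨ cong (_* w y) (ℕ.*-comm ⟦ q ⟧ ⟦ l ⟧) ⟩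
        ⟦ l ⟧ * ⟦ q ⟧ * w y    ≡⟨ cong (_* w y) (⟦⟧-× l q) ⟨
        ⟦ l ×-dec q ⟧ * w y    ∎
        where
        q = conˣ c′ ~? conʸ c
        l = labelˣ c′ y ≟ᴸ labelAt c i

    restrict : ∀ {f f′ : Constraint X → ℕ} → (∀ c′ → conˣ c′ ~ conʸ c → f c′ ≡ f′ c′) → ∀ c′ →
               ⟦ conˣ c′ ~? conʸ c ⟧ * f c′ ≡ ⟦ conˣ c′ ~? conʸ c ⟧ * f′ c′
    restrict {f} {f′} eq c′ = go (conˣ c′ ~? conʸ c)
      where
      go : (d : Dec (conˣ c′ ~ conʸ c)) → ⟦ d ⟧ * f c′ ≡ ⟦ d ⟧ * f′ c′
      go (yes c′~c) = cong (⟦ yes c′~c ⟧ *_) (eq c′ c′~c)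
      go (no c′≁c)  = trans (cong (_* f c′) (⟦⟧-no (no c′≁c) c′≁c))
                            (sym (cong (_* f′ c′) (⟦⟧-no (no c′≁c) c′≁c)))

    classCon-≡ : classCon c ≡ D * classVar x
    classCon-≡ = begin
      classCon c
        ≡⟨ ∑-cong (finiteConstraint X) (λ c′ → ℕ.*-identityʳ ⟦ conˣ c′ ~? conʸ c ⟧) ⟨
      ∑ (finiteConstraint X) (λ c′ → ⟦ conˣ c′ ~? conʸ c ⟧ * 1)
        ≡⟨ ∑-cong (finiteConstraint X) (restrict (λ c′ c′~c →
             let y , y∈ , eq , _ = entry c c′ c′~c i in sym (entrySum-unique (λ _ → 1) c′ y y∈ eq))) ⟩
      ∑ (finiteConstraint X) (λ c′ → ⟦ conˣ c′ ~? conʸ c ⟧ * entrySum (λ _ → 1) c′)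
        ≡⟨ double-count (λ _ → 1) ⟩
      D * ∑ fin (λ y → ⟦ varˣ y ~? varʸ x ⟧ * 1)
        ≡⟨ cong (D *_) (∑-cong fin (λ y → ℕ.*-identityʳ ⟦ varˣ y ~? varʸ x ⟧)) ⟩
      D * classVar x ∎
      where open ≡-Reasoning

    Tuples : Finite (Vec (Fin (size A)) (ar σ (proj₁ c)))
    Tuples = finiteVec fin (ar σ (proj₁ c))

    -- Only the image of `c′` contributes to the sum. Its `i`-th entry is `g y`, where `y` is the
    -- element of `c′` found by `entry`.
    marginal-term : ∀ a c′ → conˣ c′ ~ conʸ c →
      ∑ Tuples (λ b → ⟦ image c′ ≟ᵀ (proj₁ c , b) ⟧ * ⟦ lookup b i ≟ a ⟧) ≡ entrySum (λ y → ⟦ g y ≟ a ⟧) c′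
    marginal-term a c′@(R , t′ , p′) c′~c with entry c c′ c′~c i
    -- The label contains the relation symbol, so `c` and `c′` have the same one.
    ... | y , y∈ , eq , _ with refl ← cong proj₁ eq = begin
      ∑ Tuples (λ b → ⟦ image c′ ≟ᵀ (R , b) ⟧ * ⟦ lookup b i ≟ a ⟧)
        ≡⟨ ∑-single Tuples _ (map g t′) (λ b b≢ → cong (_* ⟦ lookup b i ≟ a ⟧)
             (⟦⟧-no (image c′ ≟ᵀ (R , b)) (λ eq′ → b≢ (sym (image-injective eq′))))) ⟩
      ⟦ image c′ ≟ᵀ (R , map g t′) ⟧ * ⟦ lookup (map g t′) i ≟ a ⟧
        ≡⟨ trans (cong (_* ⟦ lookup (map g t′) i ≟ a ⟧) (⟦⟧-yes (image c′ ≟ᵀ (R , map g t′)) refl)) (ℕ.*-identityˡ ⟦ lookup (map g t′) i ≟ a ⟧) ⟩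
      ⟦ lookup (map g t′) i ≟ a ⟧
        ≡⟨ cong (λ b → ⟦ b ≟ a ⟧) (trans (Vec.lookup-map i g t′)
             (cong g (label-lookup {σ} {s = t′} {proj₁ (proj₂ c)} eq i refl))) ⟩
      ⟦ g y ≟ a ⟧
        ≡⟨ entrySum-unique (λ y → ⟦ g y ≟ a ⟧) c′ y y∈ eq ⟨
      entrySum (λ y → ⟦ g y ≟ a ⟧) c′ ∎
      where
      open ≡-Reasoning
      image-injective : ∀ {b} → image c′ ≡ (R , b) → map g t′ ≡ b
      image-injective = Product.,-injectiveʳ-UIP (Decidable⇒UIP.≡-irrelevant _≟_)

    marginalSum : Fin (size A) → ℕ
    marginalSum a = ∑ Tuples (λ b → conCount c (proj₁ c , b) * ⟦ lookup b i ≟ a ⟧)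

    marginalSum-≡ : ∀ a → marginalSum a ≡ D * varCount x a
    marginalSum-≡ a = begin
      marginalSum a
        ≡⟨ ∑-cong Tuples (λ b → ∑-*ʳ (finiteConstraint X) ⟦ lookup b i ≟ a ⟧
             (λ c′ → ⟦ (conˣ c′ ~? conʸ c) ×-dec (image c′ ≟ᵀ (proj₁ c , b)) ⟧)) ⟨
      ∑ Tuples (λ b → ∑ (finiteConstraint X) (λ c′ →
        ⟦ (conˣ c′ ~? conʸ c) ×-dec (image c′ ≟ᵀ (proj₁ c , b)) ⟧ * ⟦ lookup b i ≟ a ⟧))
        ≡⟨ ∑-swap Tuples (finiteConstraint X) _ ⟩
      ∑ (finiteConstraint X) (λ c′ → ∑ Tuples (λ b →
        ⟦ (conˣ c′ ~? conʸ c) ×-dec (image c′ ≟ᵀ (proj₁ c , b)) ⟧ * ⟦ lookup b i ≟ a ⟧))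
        ≡⟨ ∑-cong (finiteConstraint X) (λ c′ → trans
             (∑-cong Tuples (λ b → trans
               (cong (_* ⟦ lookup b i ≟ a ⟧) (⟦⟧-× (conˣ c′ ~? conʸ c) (image c′ ≟ᵀ (proj₁ c , b))))
               (ℕ.*-assoc ⟦ conˣ c′ ~? conʸ c ⟧ ⟦ image c′ ≟ᵀ (proj₁ c , b) ⟧ ⟦ lookup b i ≟ a ⟧)))
             (∑-*ˡ Tuples ⟦ conˣ c′ ~? conʸ c ⟧ (λ b → ⟦ image c′ ≟ᵀ (proj₁ c , b) ⟧ * ⟦ lookup b i ≟ a ⟧))) ⟩
      ∑ (finiteConstraint X) (λ c′ → ⟦ conˣ c′ ~? conʸ c ⟧ *
        ∑ Tuples (λ b → ⟦ image c′ ≟ᵀ (proj₁ c , b) ⟧ * ⟦ lookup b i ≟ a ⟧))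
        ≡⟨ ∑-cong (finiteConstraint X) (restrict (marginal-term a)) ⟩
      ∑ (finiteConstraint X) (λ c′ → ⟦ conˣ c′ ~? conʸ c ⟧ * entrySum (λ y → ⟦ g y ≟ a ⟧) c′)
        ≡⟨ double-count (λ y → ⟦ g y ≟ a ⟧) ⟩
      D * ∑ fin (λ y → ⟦ varˣ y ~? varʸ x ⟧ * ⟦ g y ≟ a ⟧)
        ≡⟨ cong (D *_) (∑-cong fin (λ y → ⟦⟧-× (varˣ y ~? varʸ x) (g y ≟ a))) ⟨
      D * varCount x a ∎
      where open ≡-Reasoning

    -- The marginal equation after multiplying out its denominators `classVar x` and `classCon c`;
    -- the factor `D` appears on both sides.
    marginal-cross : ∀ a → varCount x a * classCon c ≡ marginalSum a * classVar x
    marginal-cross a = begin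
      varCount x a * classCon c          ≡⟨ cong (varCount x a *_) classCon-≡ ⟩
      varCount x a * (D * classVar x)    ≡⟨ ℕ.*-assoc (varCount x a) D (classVar x) ⟨
      varCount x a * D * classVar x      ≡⟨ cong (_* classVar x) (ℕ.*-comm (varCount x a) D) ⟩
      D * varCount x a * classVar x      ≡⟨ cong (_* classVar x) (marginalSum-≡ a) ⟨
      marginalSum a * classVar x         ∎
      where open ≡-Reasoning

  suc-pred : ∀ {m} → 1 ≤ m → suc (ℕ.pred m) ≡ m
  suc-pred (s≤s _) = refl

  -- A predecessor, because `_/suc_` adds one to its denominator.
  varDen : Fin (size Y) → ℕ
  varDen x = ℕ.pred (classVar x)

  conDen : Constraint Y → ℕ
  conDen c = ℕ.pred (classCon c)

  suc-varDen : ∀ x → suc (varDen x) ≡ classVar x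
  suc-varDen x = suc-pred (classVar-pos x)

  suc-conDen : ∀ c → suc (conDen c) ≡ classCon c
  suc-conDen c = suc-pred (classCon-pos c)

  ∑-varCount : ∀ x → ∑ fin (varCount x) ≡ classVar x
  ∑-varCount x = trans (∑-swap fin fin _) (∑-cong fin λ y → begin
    ∑ fin (λ a → ⟦ (varˣ y ~? varʸ x) ×-dec (g y ≟ a) ⟧)
      ≡⟨ ∑-cong fin (λ a → ⟦⟧-× (varˣ y ~? varʸ x) (g y ≟ a)) ⟩
    ∑ fin (λ a → ⟦ varˣ y ~? varʸ x ⟧ * ⟦ g y ≟ a ⟧)
      ≡⟨ ∑-single fin _ (g y) (λ a a≢ → trans (cong (⟦ varˣ y ~? varʸ x ⟧ *_) (⟦⟧-no (g y ≟ a) (a≢ ∘ sym)))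
           (ℕ.*-zeroʳ ⟦ varˣ y ~? varʸ x ⟧)) ⟩
    ⟦ varˣ y ~? varʸ x ⟧ * ⟦ g y ≟ g y ⟧
      ≡⟨ trans (cong (⟦ varˣ y ~? varʸ x ⟧ *_) (⟦⟧-yes (g y ≟ g y) refl)) (ℕ.*-identityʳ ⟦ varˣ y ~? varʸ x ⟧) ⟩
    ⟦ varˣ y ~? varʸ x ⟧ ∎)
    where open ≡-Reasoning

  conCount-zero : ∀ c b → (∀ c′ → conˣ c′ ~ conʸ c → image c′ ≢ b) →
                  conCount c b /suc conDen c ≡ 0ℚ
  conCount-zero c b none = trans
    (cong (_/suc conDen c) (∑-zero (finiteConstraint X) (λ c′ → ⟦⟧-no ((conˣ c′ ~? conʸ c) ×-dec (image c′ ≟ᵀ b)) (λ (c′~c , eq) → none c′ c′~c eq))))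
    (0/suc (conDen c))

  blpSolution : BLPSolution Y A
  blpSolution = record
    { pv       = λ x a → varCount x a /suc varDen x
    ; pc       = λ c b → conCount c (proj₁ c , b) /suc conDen c
    ; pv-range = λ x a → /suc-range (varDen x) (ℕ.≤-trans
                   (∑-mono fin (λ y → ⟦⟧-mono ((varˣ y ~? varʸ x) ×-dec (g y ≟ a)) (varˣ y ~? varʸ x) proj₁))
                   (ℕ.≤-reflexive (sym (suc-varDen x))))
    ; pc-range = λ c b → /suc-range (conDen c) (ℕ.≤-trans
                   (∑-mono (finiteConstraint X) (λ c′ → ⟦⟧-mono ((conˣ c′ ~? conʸ c) ×-dec (image c′ ≟ᵀ (proj₁ c , b))) (conˣ c′ ~? conʸ c) proj₁))
                   (ℕ.≤-reflexive (sym (suc-conDen c))))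
    ; pv-sum   = λ x → begin
        sumFin {σ} (size A) (λ a → varCount x a /suc varDen x)  ≡⟨ sumFin-/suc {σ} (varDen x) (size A) (varCount x) ⟩
        ∑ fin (varCount x) /suc varDen x                        ≡⟨ cong (_/suc varDen x) (trans (∑-varCount x) (sym (suc-varDen x))) ⟩
        suc (varDen x) /suc varDen x                            ≡⟨ suc/suc (varDen x) ⟩
        1ℚ                                                      ∎
    ; marginal = λ c a i → sym (begin
        sumTuples {σ} (size A) (ar σ (proj₁ c))
          (λ b → if ⌊ lookup b i ≟ a ⌋ then conCount c (proj₁ c , b) /suc conDen c else 0ℚ)
          ≡⟨ sumTuples-/suc {σ} (conDen c) (size A) (ar σ (proj₁ c)) _ _ (λ b → if-/suc (lookup b i ≟ a) _ (conDen c)) ⟩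
        marginalSum c i a /suc conDen c
          ≡⟨ /suc-cong {d = conDen c} (trans (cong (marginalSum c i a *_) (suc-varDen (x c i)))
               (trans (sym (marginal-cross c i a)) (cong (varCount (x c i) a *_) (sym (suc-conDen c))))) ⟩
        varCount (x c i) a /suc varDen (x c i) ∎)
    -- A tuple of nonzero weight is the image of a constraint of `X`, and `g` is a homomorphism.
    ; support  = λ c b b∉A → conCount-zero c (proj₁ c , b) λ { (R , t , p) _ refl →
                   subst T b∉A (proj₂ X⟶A R t p) }
    }
    where open ≡-Reasoning

  sa1Solution : SA1Solution Y A
  sa1Solution = record
    { blp        = blpSolution
    -- If positions `i` and `j` of `c` hold the same element, its label marks both. In a constraint
    -- of the same class they then hold one element `y`, with one image `g y`.
    ; consistent = λ c b i j ti≡tj bi≢bj → conCount-zero c (proj₁ c , b)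
        λ { c′@(R , t′ , p′) c′~c refl →
          let y , _ , eq , _ = entry c c′ c′~c i in
          bi≢bj (trans (Vec.lookup-map i g t′) (trans
            (cong g (trans (label-lookup {σ} {s = t′} {proj₁ (proj₂ c)} eq i refl)
              (sym (label-lookup {σ} {s = t′} {proj₁ (proj₂ c)} eq j (sym ti≡tj)))))
            (sym (Vec.lookup-map j g t′)))) }
    }

-- The structure of multisets

common-value : ∀ {n k} (f : Fin n → Fin (suc k)) → (∀ i j → f i ≡ f j) → ∃ λ c → ∀ i → f i ≡ c
-- An empty family fixes no value; a nullary tuple of the cover receives index `zero`.
common-value {zero}  f const = zero , λ ()
common-value {suc n} f const = f zero , λ i → const i zero

module Closed⇒Symmetric {σ : Signature} (A : Structure σ) (closed : CSPClosedUnder≡₁ A) (k : ℕ) where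

  -- `r` bounds all arities. Since `N` exceeds `n * r`, some value is taken on `r` of the `N` copies
  -- of a multiset; since `N` is at least `r`, the positions of a tuple can be given different
  -- copies.
  n r N : ℕ
  n = size A
  r = ∑ fin (ar σ)
  N = suc (suc n * r)

  -- The k + 1-element multisets over A are represented by vectors.
  V : Set
  V = Vec (Fin n) (suc k)

  finiteV : Finite V
  finiteV = finiteVec fin (suc k)

  mult : V → Fin n → ℕ
  mult v = multiplicity _≟_ fin (lookup v)

  Rows : ∀ R → Vec V (ar σ R) → Vec (Vec (Fin n) (ar σ R)) (suc k) → Set
  Rows R vs ts = (∀ j → T (rel A R (lookup ts j))) ×
                 (∀ i a → multiplicity _≟_ fin (λ j → lookup (lookup ts j) i) a ≡ mult (lookup vs i) a)

  rows? : ∀ R vs → Dec (∃ (Rows R vs))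
  rows? R vs = any? (finiteVec (finiteVec fin (ar σ R)) (suc k)) λ ts →
    Fin.all? (λ j → T? (rel A R (lookup ts j))) ×-dec
    Fin.all? (λ i → Fin.all? λ a → _ ℕ.≟ _)

  -- Only tuples with distinct entries are related, as required for coverings; the N copies of
  -- each multiset leave enough such tuples to recover a map on the multisets by pigeonhole.
  finiteE : Finite (V × Fin N)
  finiteE = finite× finiteV fin

  Element : Set
  Element = Fin (card finiteE)

  element : V → Fin N → Element
  element v m = from (enum finiteE) (v , m)

  multiset : Element → V
  multiset x = proj₁ (to (enum finiteE) x)

  Distinct : ∀ {m} → Vec Element m → Set
  Distinct t = ∀ i j → lookup t i ≡ lookup t j → i ≡ j

  related? : ∀ R (t : Vec Element (ar σ R)) → Dec (Distinct t × ∃ (Rows R (map multiset t)))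
  related? R t =
    Fin.all? (λ i → Fin.all? λ j → (lookup t i ≟ lookup t j) Dec.→-dec (i ≟ j)) ×-dec
    rows? R (map multiset t)

  multiset-element : ∀ v m → multiset (element v m) ≡ v
  multiset-element v m = cong proj₁ (strictlyInverseˡ (enum finiteE) (v , m))

  element-injective : ∀ {v w m m′} → element v m ≡ element w m′ → v ≡ w × m ≡ m′
  element-injective eq = cong proj₁ eq′ , cong proj₂ eq′
    where eq′ = trans (sym (strictlyInverseˡ (enum finiteE) _))
                  (trans (cong (to (enum finiteE)) eq) (strictlyInverseˡ (enum finiteE) _))

  tuple : ∀ {m} → Vec V m → (Fin m → Fin N) → Vec Element m
  tuple vs e = tabulate λ i → element (lookup vs i) (e i)

  map-multiset-tuple : ∀ {m} (vs : Vec V m) e → map multiset (tuple vs e) ≡ vs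
  map-multiset-tuple vs e = vec-ext λ i → trans (Vec.lookup-map i multiset (tuple vs e))
    (trans (cong multiset (Vec.lookup∘tabulate _ i)) (multiset-element _ _))

  tuple-related : ∀ R vs (e : Fin (ar σ R) → Fin N) ts → Rows R vs ts →
    (∀ i j → lookup vs i ≡ lookup vs j → e i ≡ e j → i ≡ j) → T ⌊ related? R (tuple vs e) ⌋
  tuple-related R vs e ts rows inj = fromWitness
    ( (λ i j eq → let v≡ , e≡ = element-injective (trans (sym (Vec.lookup∘tabulate _ i))
                                   (trans eq (Vec.lookup∘tabulate _ j))) in inj i j v≡ e≡)
    , ts , subst (λ us → Rows R us ts) (sym (map-multiset-tuple vs e)) rows)

  ar≤r : ∀ R → ar σ R ≤ r
  ar≤r R = ∑-≤ fin (ar σ) R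

  r≤N : r ≤ N
  r≤N = ℕ.≤-trans (ℕ.m≤m+n r (n * r)) (ℕ.n≤1+n _)

  X : Structure σ
  X .size       = card finiteE
  X .rel R t    = ⌊ related? R t ⌋
  -- One tuple of `A`, repeated in every row, relates constant multisets. Using copy number `i` at
  -- position `i` keeps the entries distinct when `t` has repetitions.
  X .nonempty R =
    let t , p = nonempty A R
        vs    = map (replicate (suc k)) t
        e     = λ i → Fin.inject≤ i (ℕ.≤-trans (ar≤r R) r≤N)
    in tuple vs e , tuple-related R vs e (replicate (suc k) t)
      ( (λ j → subst (T ∘ rel A R) (sym (Vec.lookup-replicate j t)) p)
      , λ i a → ∑-cong fin λ j → cong (λ b → ⟦ b ≟ a ⟧) (begin
          lookup (lookup (replicate (suc k) t) j) i  ≡⟨ cong (λ s → lookup s i) (Vec.lookup-replicate j t) ⟩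
          lookup t i                                 ≡⟨ Vec.lookup-replicate j (lookup t i) ⟨
          lookup (replicate (suc k) (lookup t i)) j  ≡⟨ cong (λ v → lookup v j) (Vec.lookup-map i _ t) ⟨
          lookup (lookup vs i) j                     ∎))
      (λ i j _ → Fin.inject≤-injective _ _ i j)
    where open ≡-Reasoning

  open Covering X k (λ R t p → proj₁ (toWitness p))

  align : ∀ {R} vs ts → Rows R vs ts → ∀ i →
          Σ (Permutation′ (suc k)) λ ρ → ∀ j → lookup (lookup vs i) (ρ ⟨$⟩ʳ j) ≡ lookup (lookup ts j) i
  align vs ts (_ , mult≡) i = multiplicity≗⇒↔ _≟_ fin fin (λ j → lookup (lookup ts j) i) (lookup (lookup vs i)) (mult≡ i)

  -- The permutation at position `i` sends the number of a row to the place of its `i`-th entry in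
  -- the vector representing the multiset. The identity is the default for tuples without rows.
  twist : Twist X k
  twist R t i with rows? R (map multiset t)
  ... | yes (ts , rows) = proj₁ (align (map multiset t) ts rows i)
  ... | no _            = Perm.id

  twist-rows : ∀ R t → T (rel X R t) → Σ (Vec (Vec (Fin n) (ar σ R)) (suc k)) λ ts →
    (∀ j → T (rel A R (lookup ts j))) ×
    (∀ i j → lookup (multiset (lookup t i)) (twist R t i ⟨$⟩ʳ j) ≡ lookup (lookup ts j) i)
  twist-rows R t p with rows? R (map multiset t) | proj₂ (toWitness {a? = related? R t} p)
  ... | yes (ts , rows) | _  = ts , proj₁ rows , λ i j →
    trans (cong (λ v → lookup v (proj₁ (align (map multiset t) ts rows i) ⟨$⟩ʳ j)) (sym (Vec.lookup-map i multiset t)))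
      (proj₂ (align (map multiset t) ts rows i) j)
  ... | no ¬rows        | yr = contradiction yr ¬rows

  -- A point goes to the entry of its multiset numbered by its sheet. On a constraint with common
  -- index `j`, the twists turn these entries into row `j`, a tuple of `A`.
  twisted⟶A : cover twist ⟶ A
  twisted⟶A = h , λ R u p →
    let q , c      = coverRel⁻ twist R u p
        ts , ∈A , eq = twist-rows R (map base u) q
        j , index≡j  = common-value (index twist R (map base u) u) c
    in subst (T ∘ rel A R) (vec-ext λ i → let ρ = twist R (map base u) i in sym (begin
         lookup (map h u) i
           ≡⟨ Vec.lookup-map i h u ⟩
         lookup (multiset (base (lookup u i))) (sheet (lookup u i))
           ≡⟨ cong₂ (λ x s → lookup (multiset x) s) (Vec.lookup-map i base u) (inverseʳ ρ) ⟨
         lookup (multiset (lookup (map base u) i)) (ρ ⟨$⟩ʳ index twist R (map base u) u i)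
           ≡⟨ cong (λ s → lookup (multiset (lookup (map base u) i)) (ρ ⟨$⟩ʳ s)) (index≡j i) ⟩
         lookup (multiset (lookup (map base u) i)) (ρ ⟨$⟩ʳ j)
           ≡⟨ eq i j ⟩
         lookup (lookup ts j) i ∎)) (∈A j)
    where
    open ≡-Reasoning
    h : Point → Fin n
    h y = lookup (multiset (base y)) (sheet y)

  untwisted : Twist X k
  untwisted _ _ _ = Perm.id

  -- Sheet `zero` of the untwisted covering is a copy of `X`, and closure moves the homomorphism
  -- from the twisted covering to the untwisted one.
  X⟶A : X ⟶ A
  X⟶A =
    let g , g-hom = proj₁ (closed _ _ (covers-≡₁ twist untwisted)) twisted⟶A
    in (λ x → g (point x zero)) , λ R t p →
      subst (T ∘ rel A R)
        (vec-ext λ i → trans (Vec.lookup-map i g (lift untwisted R t zero))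
          (trans (cong g (lookup-lift untwisted R t zero i)) (sym (Vec.lookup-map i _ t))))
        (g-hom R (lift untwisted R t zero) (lift-rel untwisted R t zero p))

  -- With `r` copies of `v` sharing a value, a tuple can use a different copy at each position, even
  -- if `v` occurs at all of them.
  popular : ∀ v → ∃ λ a → Σ (Fin r → Fin N) λ e →
            (∀ i → proj₁ X⟶A (element v (e i)) ≡ a) × (∀ i j → e i ≡ e j → i ≡ j)
  popular v = pigeonhole _≟_ fin fin (λ m → proj₁ X⟶A (element v m)) r (s≤s (ℕ.m≤n+m (n * r) r))

  F : V → Fin n
  F v = proj₁ (popular v)

  -- Position `i` uses the `i`-th popular copy of its multiset. The resulting entries are distinct,
  -- so the tuple is related in `X`, and its image consists of the values of `F`.
  F-preserves : ∀ R vs ts → Rows R vs ts → T (rel A R (map F vs))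
  F-preserves R vs ts rows = subst (T ∘ rel A R)
    (vec-ext λ i → begin
      lookup (map (proj₁ X⟶A) (tuple vs e)) i         ≡⟨ Vec.lookup-map i _ (tuple vs e) ⟩
      proj₁ X⟶A (lookup (tuple vs e) i)               ≡⟨ cong (proj₁ X⟶A) (Vec.lookup∘tabulate _ i) ⟩
      proj₁ X⟶A (element (lookup vs i) (e i))         ≡⟨ proj₁ (proj₂ (proj₂ (popular (lookup vs i)))) (ι i) ⟩
      F (lookup vs i)                                 ≡⟨ Vec.lookup-map i F vs ⟨
      lookup (map F vs) i                             ∎)
    (proj₂ X⟶A R (tuple vs e) (tuple-related R vs e ts rows λ i j v≡ e≡ →
      Fin.inject≤-injective _ _ i j (pick-injective v≡ e≡)))
    where
    open ≡-Reasoning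
    ι : Fin (ar σ R) → Fin r
    ι i = Fin.inject≤ i (ar≤r R)
    pick : V → Fin r → Fin N
    pick v = proj₁ (proj₂ (popular v))
    e : Fin (ar σ R) → Fin N
    e i = pick (lookup vs i) (ι i)
    pick-injective : ∀ {v w i j} → v ≡ w → pick v i ≡ pick w j → i ≡ j
    pick-injective {v} refl = proj₂ (proj₂ (proj₂ (popular v))) _ _

  counts : V → Vec ℕ n
  counts v = tabulate (mult v)

  find : ∀ c → Dec (∃ λ v → counts v ≡ c)
  find c = any? finiteV (λ v → Vec.≡-dec ℕ._≟_ (counts v) c)

  choose : ∀ {c} → Dec (∃ λ v → counts v ≡ c) → V → V
  choose (yes (w , _)) _ = w
  choose (no _)        v = v

  -- `F` may differ on two vectors for the same multiset. The search depends on `counts v` alone, so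
  -- it returns one representative for all of them; the fallback `v` makes `choose` total.
  canonical : V → V
  canonical v = choose (find (counts v)) v

  mult-canonical : ∀ v a → mult (canonical v) a ≡ mult v a
  mult-canonical v a with find (counts v)
  ... | no _        = refl
  ... | yes (w , eq) = trans (sym (Vec.lookup∘tabulate (mult w) a))
                         (trans (cong (λ c → lookup c a) eq) (Vec.lookup∘tabulate (mult v) a))

  canonical-cong : ∀ u v → counts u ≡ counts v → canonical u ≡ canonical v
  canonical-cong u v eq rewrite eq with find (counts v)
  ... | yes _   = refl
  ... | no none = contradiction (v , refl) none

  symmetric : Σ (V → Fin n) λ f → IsPolymorphism A (suc k) f × IsSymmetric {σ} (suc k) f
  symmetric = F ∘ canonical , polymorphism , λ as ρ → cong F (canonical-cong _ _
    (Vec.tabulate-cong λ a → sym (multiplicity-↔ _≟_ fin fin ρ _ (lookup as)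
      (λ j → sym (Vec.lookup∘tabulate (λ i → lookup as (ρ ⟨$⟩ʳ i)) j)) a)))
    where
    -- The tuples `ts` are themselves rows for the canonical representatives of their columns,
    -- because `canonical` preserves multiplicities.
    polymorphism : IsPolymorphism A (suc k) (F ∘ canonical)
    polymorphism R ts ∈A = subst (T ∘ rel A R) (sym (Vec.tabulate-∘ F _))
      (F-preserves R (tabulate λ i → canonical (column i)) ts (∈A , λ i a → begin
        multiplicity _≟_ fin (λ j → lookup (lookup ts j) i) a
          ≡⟨ ∑-cong fin (λ j → cong (λ b → ⟦ b ≟ a ⟧) (Vec.lookup-map j _ ts)) ⟨
        mult (column i) a
          ≡⟨ mult-canonical (column i) a ⟨
        mult (canonical (column i)) a
          ≡⟨ cong (λ v → mult v a) (Vec.lookup∘tabulate _ i) ⟨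
        mult (lookup (tabulate λ i → canonical (column i)) i) a ∎))
      where
      open ≡-Reasoning
      column : Fin (ar σ R) → V
      column i = map (λ t → lookup t i) ts

-- The cycle of implications

theorem5p2 : (σ : Signature) (A : Structure σ) →
    (CSPClosedUnder≡₁ A ⇔ SA1Decides A) ×
    (SA1Decides A ⇔ BLPDecides A) ×
    (BLPDecides A ⇔ HasAllSymmetricPolymorphisms A)
theorem5p2 σ A =
  -- Closure gives symmetric polymorphisms, these give BLP, BLP gives SA¹, and SA¹ gives closure;
  -- every direction is a stretch of this cycle.
  mk⇔ (blp⇒sa1 ∘ symmetric⇒blp ∘ closed⇒symmetric) sa1⇒closed ,
  mk⇔ (symmetric⇒blp ∘ closed⇒symmetric ∘ sa1⇒closed) blp⇒sa1 ,
  mk⇔ (closed⇒symmetric ∘ sa1⇒closed ∘ blp⇒sa1) symmetric⇒blp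
  where
  symmetric⇒blp : HasAllSymmetricPolymorphisms A → BLPDecides A
  symmetric⇒blp = Symmetric⇒BLP.homomorphism A

  blp⇒sa1 : BLPDecides A → SA1Decides A
  blp⇒sa1 decides X sol = decides X (SA1Solution.blp sol)

  sa1⇒closed : SA1Decides A → CSPClosedUnder≡₁ A
  sa1⇒closed decides X Y X≡Y =
    (λ X⟶A → decides Y (≡₁⇒SA1.sa1Solution A X Y X≡Y X⟶A)) ,
    (λ Y⟶A → decides X (≡₁⇒SA1.sa1Solution A Y X (≡₁-sym X≡Y) Y⟶A))

  closed⇒symmetric : CSPClosedUnder≡₁ A → HasAllSymmetricPolymorphisms A
  closed⇒symmetric = Closed⇒Symmetric.symmetric A
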